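{- For every integer $n\ge 1$, with $$\rho_n = \left\lfloor \frac{ -3 + \sqrt{8n+17}}{2} \right\rfloor, \qquad \lambda_n = n + 2 - T_{\rho_n+1}, \qquad T_i=\binom{i+1}{2},$$ we have $$|\mathcal{Z}_{n+1}(3\underline{21})| = |\mathcal{Y}_{n+1}(1\underline{23})| = |\mathcal{Y}_{n+1}(\underline{12}3)| = \binom{\rho_n}{\lambda_n}+\binom{\rho_n+1}{\lambda_n-1}$$ and $$\operatorname{maxinv} \mathcal{S}_{n+1}(3\underline{21})= \binom{n-\rho_n +1}{2} + \binom{\rho_n + 2}{3},$$ while $$\operatorname{mininv} \mathcal{S}_{n+1}(1\underline{23}) = \operatorname{mininv} \mathcal{S}_{n+1}(\underline{12}3) = \binom{n+1}{2} - \binom{\rho_n + 2}{3} - \binom{n-\rho_n +1}{2}.$$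
   Context: $\mathcal{S}_N$ is the set of permutations $\pi=\pi_1\cdots\pi_N$ of $\{1,\dots,N\}$, and $\operatorname{inv}(\pi) = |\{(i,j) : i<j,\ \pi_i>\pi_j\}|$. For a vincular pattern $\sigma$ (underlined letters must be matched by adjacent entries), $\mathcal{S}_N(\sigma)$ is the set of $\pi\in\mathcal{S}_N$ avoiding $\sigma$. Explicitly: $\pi$ avoids $3\underline{21}$ if there are no $1\le i<j<j+1\le N$ with $\pi_i>\pi_j>\pi_{j+1}$; $\pi$ avoids $1\underline{23}$ if there are no $1\le i<j<j+1\le N$ with $\pi_i<\pi_j<\pi_{j+1}$; $\pi$ avoids $\underline{12}3$ if there are no $1\le i<i+1<j\le N$ with $\pi_i<\pi_{i+1}<\pi_j$. $\operatorname{maxinv}\mathcal{S}_N(\sigma)$ and $\operatorname{mininv}\mathcal{S}_N(\sigma)$ are the maximum and minimum of $\operatorname{inv}$ over $\mathcal{S}_N(\sigma)$; $\mathcal{Z}_N(\sigma)$ and $\mathcal{Y}_N(\sigma)$ are the subsets of $\mathcal{S}_N(\sigma)$ of permutations achieving the maximum and the minimum, respectively. Convention: $\binom{a}{b}=0$ if $b<0$ or $b>a$ (for integers $a\ge 0$). -}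

module Defs where

open import Data.Empty using (⊥-elim)
open import Data.Fin.Base as Fin using (Fin; toℕ)
import Data.Fin.Properties as Fin
open import Data.Fin.Permutation using (Permutation′; _⟨$⟩ʳ_; _≈_)
open import Data.Integer.Base as ℤ using (ℤ; +_; -[1+_])
open import Data.List.Base using (length; filter; cartesianProduct; allFin)
open import Data.Nat.Base
open import Data.Nat.Combinatorics using (_C_)
open import Data.Nat.DivMod using (m≡m%n+[m/n]*n; m%n<n)
open import Data.Nat.Properties
open import Data.Nat.Tactic.RingSolver using (solve-∀)
open import Data.Product.Base using (_×_; _,_; ∃-syntax; proj₁; proj₂)
open import Function.Bundles using (Bijection)
open import Level using (0ℓ)
open import Relation.Binary.Bundles using (Setoid)
import Relation.Binary.Construct.On as On
open import Relation.Binary.PropositionalEquality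
  using (_≡_; refl; sym; trans; cong; subst; setoid)
open import Relation.Nullary using (¬_; yes; no)
open import Relation.Nullary.Decidable using (_×-dec_)
open import Relation.Unary using (Pred)

------------------------------------------------------------------------
-- Permutations

-- The one-line notation of π is π ⟨$⟩ʳ 0, …, π ⟨$⟩ʳ (N − 1): positions
-- and values are both shifted down by one, which affects neither
-- inversions nor pattern containment.

inv : ∀ {N} → Permutation′ N → ℕ
inv {N} π = length (filter
  (λ (i , j) → (i Fin.<? j) ×-dec ((π ⟨$⟩ʳ j) Fin.<? (π ⟨$⟩ʳ i)))
  (cartesianProduct (allFin N) (allFin N)))

-- Pattern letters not separated by a hyphen must be matched by adjacent
-- entries.

Avoids3-21 : ∀ {N} → Pred (Permutation′ N) 0ℓ
Avoids3-21 {N} π = ¬ (∃[ i ] ∃[ j ] ∃[ k ]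
  i Fin.< j × toℕ k ≡ suc (toℕ j) ×
  (π ⟨$⟩ʳ j) Fin.< (π ⟨$⟩ʳ i) × (π ⟨$⟩ʳ k) Fin.< (π ⟨$⟩ʳ j))

Avoids1-23 : ∀ {N} → Pred (Permutation′ N) 0ℓ
Avoids1-23 {N} π = ¬ (∃[ i ] ∃[ j ] ∃[ k ]
  i Fin.< j × toℕ k ≡ suc (toℕ j) ×
  (π ⟨$⟩ʳ i) Fin.< (π ⟨$⟩ʳ j) × (π ⟨$⟩ʳ j) Fin.< (π ⟨$⟩ʳ k))

Avoids12-3 : ∀ {N} → Pred (Permutation′ N) 0ℓ
Avoids12-3 {N} π = ¬ (∃[ i ] ∃[ j ] ∃[ k ]
  toℕ j ≡ suc (toℕ i) × j Fin.< k ×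
  (π ⟨$⟩ʳ i) Fin.< (π ⟨$⟩ʳ j) × (π ⟨$⟩ʳ j) Fin.< (π ⟨$⟩ʳ k))

------------------------------------------------------------------------
-- Extremal permutations and extremal values of inv

module _ {N : ℕ} where

  𝒵 : Pred (Permutation′ N) 0ℓ → Pred (Permutation′ N) 0ℓ
  𝒵 S π = S π × (∀ τ → S τ → inv τ ≤ inv π)

  𝒴 : Pred (Permutation′ N) 0ℓ → Pred (Permutation′ N) 0ℓ
  𝒴 S π = S π × (∀ τ → S τ → inv π ≤ inv τ)

  -- The values are integers so that formulas involving subtraction can
  -- be used without truncation.

  MaxInv : Pred (Permutation′ N) 0ℓ → ℤ → Set
  MaxInv S v = ∃[ π ] 𝒵 S π × + inv π ≡ v

  MinInv : Pred (Permutation′ N) 0ℓ → ℤ → Set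
  MinInv S v = ∃[ π ] 𝒴 S π × + inv π ≡ v

  -- Elements of a set of permutations are compared pointwise, so that
  -- neither the proof of membership nor the proofs stored in the
  -- permutation contribute to the cardinality.

  permSetoid : Setoid 0ℓ 0ℓ
  permSetoid = record
    { Carrier       = Permutation′ N
    ; _≈_           = _≈_
    ; isEquivalence = record
      { refl  = λ _ → refl
      ; sym   = λ p i → sym (p i)
      ; trans = λ p q i → trans (p i) (q i)
      }
    }

  subsetSetoid : Pred (Permutation′ N) 0ℓ → Setoid 0ℓ 0ℓ
  subsetSetoid P = On.setoid permSetoid (proj₁ {B = P})

  Card : Pred (Permutation′ N) 0ℓ → ℕ → Set
  Card P k = Bijection (setoid (Fin k)) (subsetSetoid P)

------------------------------------------------------------------------
-- Binomial coefficients with an arbitrary integer as lower entry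

binom : ℕ → ℤ → ℕ
binom a (+ b)    = a C b
binom a -[1+ _ ] = 0

T : ℕ → ℕ
T i = suc i C 2

------------------------------------------------------------------------
-- Integer square root

⌊√_⌋ : ℕ → ℕ
⌊√ zero  ⌋ = 0
⌊√ suc m ⌋ with suc ⌊√ m ⌋ * suc ⌊√ m ⌋ ≤? suc m
... | yes _ = suc ⌊√ m ⌋
... | no  _ = ⌊√ m ⌋

⌊√⌋-spec : ∀ m → ⌊√ m ⌋ * ⌊√ m ⌋ ≤ m × m < suc ⌊√ m ⌋ * suc ⌊√ m ⌋
⌊√⌋-spec zero = z≤n , s≤s z≤n
⌊√⌋-spec (suc m) with suc ⌊√ m ⌋ * suc ⌊√ m ⌋ ≤? suc m | ⌊√⌋-spec m
... | yes p | _ , q = p , ≤-<-trans q (*-mono-< (n<1+n (suc ⌊√ m ⌋)) (n<1+n (suc ⌊√ m ⌋)))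
... | no ¬p | q , _ = m≤n⇒m≤1+n q , ≰⇒> ¬p

------------------------------------------------------------------------
-- The parameters ρ and λ

-- ⌊(x − 3) / 2⌋ = ⌊(⌊x⌋ − 3) / 2⌋ for every real x. As √(8n + 17) > 4,
-- the subtraction does not truncate.

ρ : ℕ → ℕ
ρ n = (⌊√ 8 * n + 17 ⌋ ∸ 3) / 2

-- Squared form of 2ρ + 3 ≤ √(8n + 17) < 2ρ + 5, that is, of
-- ρ ≤ (−3 + √(8n + 17)) / 2 < ρ + 1.

ρ-floor : ∀ n → (2 * ρ n + 3) * (2 * ρ n + 3) ≤ 8 * n + 17
              × 8 * n + 17 < (2 * ρ n + 5) * (2 * ρ n + 5)
ρ-floor n = ≤-trans (*-mono-≤ lower lower) (proj₁ spec)
          , <-≤-trans (proj₂ spec) (*-mono-≤ upper upper)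
  where
  s = ⌊√ 8 * n + 17 ⌋
  r = (s ∸ 3) % 2
  spec = ⌊√⌋-spec (8 * n + 17)

  3≤s : 3 ≤ s
  3≤s with 3 ≤? s
  ... | yes p = p
  ... | no ¬p = ⊥-elim (<⇒≱ (proj₂ spec)
    (≤-trans (*-mono-≤ (≰⇒> ¬p) (≰⇒> ¬p))
      (≤-trans (m≤m+n 9 8) (m≤n+m 17 (8 * n)))))

  s≡ : s ≡ r + (2 * ρ n + 3)
  s≡ = trans (sym (m∸n+n≡m 3≤s))
      (trans (cong (λ t → t + 3) (trans (m≡m%n+[m/n]*n (s ∸ 3) 2)
                                 (cong (λ t → r + t) (*-comm (ρ n) 2))))
             (+-assoc r (2 * ρ n) 3))

  lower : 2 * ρ n + 3 ≤ s
  lower = subst (2 * ρ n + 3 ≤_) (sym s≡) (m≤n+m _ r)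

  arith : ∀ x → 2 + (x + 3) ≡ x + 5
  arith = solve-∀

  upper : suc s ≤ 2 * ρ n + 5
  upper = subst (suc s ≤_) (arith (2 * ρ n))
    (subst (λ t → suc t ≤ 2 + (2 * ρ n + 3)) (sym s≡)
      (+-monoˡ-≤ (2 * ρ n + 3) (m%n<n (s ∸ 3) 2)))

-- Hence n ∸ ρ n is a genuine difference.

ρ≤n : ∀ n → ρ n ≤ n
ρ≤n n with ρ n ≤? n
... | yes p = p
... | no ¬p = ⊥-elim (<⇒≱ (bound n) (≤-trans (*-mono-≤ q q) (proj₁ (ρ-floor n))))
  where
  q : 2 * suc n + 3 ≤ 2 * ρ n + 3
  q = +-monoˡ-≤ 3 (*-monoʳ-≤ 2 (≰⇒> ¬p))

  expand : ∀ n → (2 * suc n + 3) * (2 * suc n + 3)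
               ≡ suc (8 * n + 17) + (4 * (n * n) + 12 * n + 7)
  expand = solve-∀

  bound : ∀ n → 8 * n + 17 < (2 * suc n + 3) * (2 * suc n + 3)
  bound n = subst (suc (8 * n + 17) ≤_) (sym (expand n)) (m≤m+n _ _)

lam : ℕ → ℤ
lam n = + n ℤ.+ + 2 ℤ.- + T (ρ n + 1)

{-# OPTIONS --safe #-}

-- Complementing the values, reversing the positions, or both, turns the three patterns into 32-1
-- (with 21 adjacent and the maximum of inv sought). In terms of the Lehmer code
-- a_i = #{k > i : π_k < π_i}, one has π_i > π_{i+1} iff a_i > a_{i+1}, so π avoids 32-1 iff a code
-- entry can only drop to 0. Read from the right, such a code consists of k runs, each a 0 followed
-- by b_j nonzero entries, and the entries of a run are at most the position of its 0, whence
-- inv π ≤ Σ_j b_j (j + b_1 + … + b_{j-1}), with one code attaining the bound for each sequence b.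
-- For every r this sum is at most C(N − r, 2) + C(r + 2, 3), where N = k + Σ b_j; adding the runs one
-- at a time while increasing r, the defect is a sum of terms (b − r)(b − r − 1)/2 and nonnegative
-- boundary terms, and it vanishes iff k = r and all b_j ∈ {j, j + 1}, or k = r + 1 and all
-- b_j ∈ {j − 1, j}. The value r = ρ is the one for which such b exist, and the two cases are counted
-- by the two binomial coefficients.

module Submission where

open import Defs
import Algebra.Properties.CommutativeMonoid.Sum
open import Data.Bool.Base using (if_then_else_; true; false)
open import Data.Empty using (⊥-elim)
open import Data.Fin.Base as Fin using (Fin; zero; suc; toℕ; fromℕ<; opposite; punchIn)
open import Data.Fin.Permutation
  using (Permutation′; _⟨$⟩ʳ_; _⟨$⟩ˡ_; _≈_; _∘ₚ_; reverse; remove; insert;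
         punchIn-permute; remove-insert; inverseʳ)
  renaming (id to idₚ)
import Data.Fin.Properties as Fin
open import Data.Integer.Base as ℤ using (+_)
import Data.Integer.Properties as ℤ
open import Data.List.Base
  using (List; []; _∷_; _++_; length; map; lookup; filter; tabulate; cartesianProduct)
open import Data.List.Properties
  using (∷-injectiveˡ; ∷-injectiveʳ; length-map; length-++; filter-++; map-tabulate)
open import Data.List.Membership.Propositional using (_∈_)
open import Data.List.Membership.Propositional.Properties
  using (∈-map⁺; ∈-map⁻; ∈-++⁺ˡ; ∈-++⁺ʳ; ∈-++⁻; ∈-lookup)
open import Data.List.Relation.Unary.All as All using ()
open import Data.List.Relation.Unary.AllPairs using ([]; _∷_)
open import Data.List.Relation.Unary.Any using (here; index)
open import Data.List.Relation.Unary.Any.Properties using (lookup-index)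
open import Data.List.Relation.Unary.Unique.Propositional using (Unique)
import Data.List.Relation.Unary.Unique.Propositional.Properties as Unique
open import Data.Nat.Base
open import Data.Nat.Combinatorics using (_C_; nCk+nC[k+1]≡[n+1]C[k+1]; nC1≡n)
open import Data.Nat.ListAction using (sum)
open import Data.Nat.Properties
open import Data.Nat.Tactic.RingSolver using (solve-∀)
open import Data.Product.Base using (_×_; _,_; ∃-syntax; proj₁; proj₂)
open import Data.Sum.Base using (_⊎_; inj₁; inj₂)
open import Data.Unit.Base using (⊤; tt)
open import Function.Base using (_∘_; id)
open import Function.Bundles using (Bijection; Injection; _⇔_; mk⇔; Equivalence)
open import Function.Properties.Inverse using (↔⇒↣)
open import Level using (0ℓ)
open import Relation.Binary.Definitions using (tri<; tri≈; tri>)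
open import Relation.Binary.PropositionalEquality
open import Relation.Nullary using (¬_; Dec; does)
open import Relation.Nullary.Decidable using (_×-dec_; does-⇔; dec-true; dec-false)
open import Relation.Unary using (Pred; Decidable)

open Algebra.Properties.CommutativeMonoid.Sum +-0-commutativeMonoid
  using (sum-cong-≗; sum-permute; ∑-distrib-+; ∑-comm; sum-replicate-zero)
  renaming (sum to ∑)

-- Codes and their runs

Bounded : List ℕ → Set
Bounded []      = ⊤
Bounded (a ∷ c) = a ≤ length c × Bounded c

DropsToZero : List ℕ → Set
DropsToZero []          = ⊤
DropsToZero (a ∷ [])    = ⊤
DropsToZero (a ∷ b ∷ c) = (b < a → b ≡ 0) × DropsToZero (b ∷ c)

-- A code with runs b_1, …, b_k, counted from the right, is described by the list b_k ∷ … ∷ b_1 ∷ [].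

size : List ℕ → ℕ
size []       = 0
size (b ∷ bs) = b + suc (size bs)

weight : List ℕ → ℕ
weight []       = 0
weight (b ∷ bs) = b * suc (size bs) + weight bs

infix 4 _HasRuns_
-- Only the lengths of the runs and an upper bound on the entries are recorded, not the order of the
-- entries inside a run. In `extend`, `size bs` counts what lies to the right of the 0 of the run,
-- so `suc a` is at most the position of that 0, counted from the right.
data _HasRuns_ : List ℕ → List ℕ → Set where
  []     : [] HasRuns []
  start  : ∀ {c bs} → c HasRuns bs → 0 ∷ c HasRuns 0 ∷ bs
  extend : ∀ {a b c bs} → a ≤ size bs → c HasRuns b ∷ bs → suc a ∷ c HasRuns suc b ∷ bs

-- The extremal code for the given runs: every nonzero entry takes the largest value that `extend`
-- allows.
fill : List ℕ → List ℕ
fill []           = []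
fill (zero ∷ bs)  = 0 ∷ fill bs
fill (suc b ∷ bs) = suc (size bs) ∷ fill (b ∷ bs)

HasRuns-length : ∀ {c bs} → c HasRuns bs → length c ≡ size bs
HasRuns-length []           = refl
HasRuns-length (start h)    = cong suc (HasRuns-length h)
HasRuns-length (extend _ h) = cong suc (HasRuns-length h)

HasRuns-unique : ∀ {c bs bs′} → c HasRuns bs → c HasRuns bs′ → bs ≡ bs′
HasRuns-unique []           []            = refl
HasRuns-unique (start h)    (start h′)    = cong (0 ∷_) (HasRuns-unique h h′)
HasRuns-unique (extend _ h) (extend _ h′) with HasRuns-unique h h′
... | refl = refl

HasRuns-bounded : ∀ {c bs} → c HasRuns bs → Bounded c
HasRuns-bounded []        = tt
HasRuns-bounded (start h) = z≤n , HasRuns-bounded h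
HasRuns-bounded (extend {b = b} {bs = bs} a≤ h) =
  subst (_ ≤_) (sym (HasRuns-length h)) (≤-trans (s≤s a≤) (m≤n+m (suc (size bs)) b))
  , HasRuns-bounded h

-- No drop to a nonzero entry is allowed, so the nonzero entries of a run increase weakly up to its
-- 0. `Bounded` limits the last of them by the number of entries to its right, and this limit passes
-- leftwards through the run.
runs : ∀ c → Bounded c → DropsToZero c → ∃[ bs ] c HasRuns bs
runs []                  _        _       = [] , []
runs (zero ∷ [])         _        _       = _ , start []
runs (zero ∷ b ∷ c)      (_ , v)  (_ , d) = _ , start (proj₂ (runs (b ∷ c) v d))
runs (suc a ∷ [])        (() , _) _
runs (suc a ∷ zero ∷ c)  (s≤s a≤ , v) (_ , d) with runs (zero ∷ c) v d
... | _ , start h = _ , extend (subst (a ≤_) (HasRuns-length h) a≤) (start h)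
runs (suc a ∷ suc b ∷ c) (_ , v)  (f , d) with runs (suc b ∷ c) v d
... | _ , extend b≤ h = _ , extend (≤-trans a≤b b≤) (extend b≤ h)
  where
  a≤b : a ≤ b
  a≤b = s≤s⁻¹ (≮⇒≥ λ b<a → 1+n≢0 (f b<a))

HasRuns-sum : ∀ {c bs} → c HasRuns bs → sum c ≤ weight bs
HasRuns-sum []        = z≤n
HasRuns-sum (start h) = HasRuns-sum h
HasRuns-sum (extend {a} {b} {c} {bs} a≤ h) = begin
  suc a + sum c                                ≤⟨ +-mono-≤ (s≤s a≤) (HasRuns-sum h) ⟩
  suc (size bs) + (b * suc (size bs) + weight bs) ≡⟨ +-assoc (suc (size bs)) _ _ ⟨
  suc b * suc (size bs) + weight bs            ∎
  where open ≤-Reasoning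

+-tight : ∀ {a b c d} → a ≤ c → b ≤ d → a + b ≡ c + d → a ≡ c × b ≡ d
+-tight {a} {b} {c} {d} a≤c b≤d eq = a≡c , +-cancelˡ-≡ a b d (trans eq (cong (_+ d) (sym a≡c)))
  where
  a≡c : a ≡ c
  a≡c = ≤-antisym a≤c (+-cancelʳ-≤ d c a (≤-trans (≤-reflexive (sym eq)) (+-monoʳ-≤ a b≤d)))

-- A sum of termwise bounds is attained only if each bound is, and `fill` consists of exactly these
-- bounds.
HasRuns-tight : ∀ {c bs} → c HasRuns bs → sum c ≡ weight bs → c ≡ fill bs
HasRuns-tight []        _  = refl
HasRuns-tight (start h) eq = cong (0 ∷_) (HasRuns-tight h eq)
HasRuns-tight (extend {bs = bs} a≤ h) eq
  with +-tight (s≤s a≤) (HasRuns-sum h) (trans eq (+-assoc (suc (size bs)) _ _))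
... | refl , eq′ = cong (_ ∷_) (HasRuns-tight h eq′)

fill-HasRuns : ∀ bs → fill bs HasRuns bs
fill-HasRuns []           = []
fill-HasRuns (zero ∷ bs)  = start (fill-HasRuns bs)
fill-HasRuns (suc b ∷ bs) = extend ≤-refl (fill-HasRuns (b ∷ bs))

fill-injective : ∀ {bs bs′} → fill bs ≡ fill bs′ → bs ≡ bs′
fill-injective {bs} {bs′} eq =
  HasRuns-unique (fill-HasRuns bs) (subst (_HasRuns bs′) (sym eq) (fill-HasRuns bs′))

-- All nonzero entries of one run are equal, so a drop can occur only at its 0.
fill-drops : ∀ bs → DropsToZero (fill bs)
fill-drops []                       = tt
fill-drops (zero ∷ [])              = tt
fill-drops (zero ∷ bs@(zero ∷ _))   = (λ _ → refl) , fill-drops bs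
fill-drops (zero ∷ bs@(suc _ ∷ _))  = (λ ()) , fill-drops bs
fill-drops (suc zero ∷ bs)          = (λ _ → refl) , fill-drops (zero ∷ bs)
fill-drops (suc (suc b) ∷ bs)       = (λ lt → ⊥-elim (<-irrefl refl lt)) , fill-drops (suc b ∷ bs)

fill-sum : ∀ bs → sum (fill bs) ≡ weight bs
fill-sum []           = refl
fill-sum (zero ∷ bs)  = fill-sum bs
fill-sum (suc b ∷ bs) =
  trans (cong (λ x → suc (size bs) + x) (fill-sum (b ∷ bs))) (sym (+-assoc (suc (size bs)) _ _))

-- The maximal weight

-- (b − r)(b − r − 1)
gap : ℕ → ℕ → ℕ
gap zero    zero    = 0
gap (suc b) zero    = suc b * b
gap zero    (suc r) = suc r * suc (suc r)
gap (suc b) (suc r) = gap b r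

-- This expands (b - r)(b - r - 1) with the negative terms moved to the left. The product depends
-- only on b - r, which is why `gap` strips both arguments together.
gap-identity : ∀ b r → gap b r + (2 * (b * r) + b) ≡ b * b + (r * r + r)
gap-identity zero    zero    = refl
gap-identity (suc b) zero    = eq b
  where
  eq : ∀ b → suc b * b + (2 * (suc b * 0) + suc b) ≡ suc b * suc b + 0
  eq = solve-∀
gap-identity zero    (suc r) = eq r
  where
  eq : ∀ r → suc r * suc (suc r) + 0 ≡ suc r * suc r + suc r
  eq = solve-∀
gap-identity (suc b) (suc r) = trans (lhs (gap b r) b r)
  (trans (cong (_+ (2 * b + 2 * r + 3)) (gap-identity b r)) (rhs b r))
  where
  lhs : ∀ g b r → g + (2 * (suc b * suc r) + suc b) ≡ g + (2 * (b * r) + b) + (2 * b + 2 * r + 3)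
  lhs = solve-∀
  rhs : ∀ b r → b * b + (r * r + r) + (2 * b + 2 * r + 3) ≡ suc b * suc b + (suc r * suc r + suc r)
  rhs = solve-∀

gap-lower : ∀ r → gap r r ≡ 0
gap-lower zero    = refl
gap-lower (suc r) = gap-lower r

gap-upper : ∀ r → gap (suc r) r ≡ 0
gap-upper zero    = refl
gap-upper (suc r) = gap-upper r

gap≡0 : ∀ b r → gap b r ≡ 0 → b ≡ r ⊎ b ≡ suc r
gap≡0 zero          zero    _  = inj₁ refl
gap≡0 (suc zero)    zero    _  = inj₂ refl
gap≡0 (suc (suc b)) zero    ()
gap≡0 zero          (suc r) ()
gap≡0 (suc b)       (suc r) eq with gap≡0 b r eq
... | inj₁ b≡r  = inj₁ (cong suc b≡r)
... | inj₂ b≡1+r = inj₂ (cong suc b≡1+r)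

-- 2 C(r + 2, 3)
tet : ℕ → ℕ
tet zero    = 0
tet (suc r) = suc r * suc (suc r) + tet r

-- The leftmost run and r are stripped together, so each run is compared with its own value of r.
-- The clauses for `[]` and for r = 0 hold the boundary terms that arise when the runs or r are
-- exhausted first. That all terms are natural numbers is what bounds the weight.
defect : List ℕ → ℕ → ℕ
defect []       r       = r * suc r + tet r
defect (b ∷ bs) zero    = defect bs zero + (gap b 0 + 2 * size bs)
defect (b ∷ bs) (suc r) = defect bs r + gap b (suc r)

-- This is 2 (C(N − r, 2) + C(r + 2, 3) − weight bs) = defect bs r for N = size bs, with terms moved
-- so that no subtraction occurs.
weight-identity : ∀ bs r → 2 * weight bs + (2 * (size bs * r) + size bs) + defect bs r
                         ≡ size bs * size bs + (r * r + r) + tet r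
weight-identity []       r       = eq r (tet r)
  where
  eq : ∀ r t → r * suc r + t ≡ r * r + r + t
  eq = solve-∀
weight-identity (b ∷ bs) zero    =
  trans (lhs (weight bs) (size bs) (defect bs 0) (gap b 0) b)
  (trans (cong₂ (λ x y → x + y + R) (weight-identity bs 0) (gap-identity b 0))
         (rhs (size bs) b))
  where
  -- `R` is what remains on both sides once the induction hypothesis and `gap-identity` have been
  -- split off.
  R = 2 * (b * size bs) + 2 * b + 1 + 2 * size bs
  lhs : ∀ w s d g b →
    2 * (b * suc s + w) + (2 * ((b + suc s) * 0) + (b + suc s)) + (d + (g + 2 * s))
    ≡ (2 * w + (2 * (s * 0) + s) + d) + (g + (2 * (b * 0) + b)) + (2 * (b * s) + 2 * b + 1 + 2 * s)
  lhs = solve-∀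
  rhs : ∀ s b → (s * s + 0 + 0) + (b * b + 0) + (2 * (b * s) + 2 * b + 1 + 2 * s)
    ≡ (b + suc s) * (b + suc s) + 0 + 0
  rhs = solve-∀
weight-identity (b ∷ bs) (suc r) =
  trans (lhs (weight bs) (size bs) (defect bs r) (gap b (suc r)) b r)
  (trans (cong₂ (λ x y → x + y + R) (weight-identity bs r) (gap-identity b (suc r)))
         (rhs (size bs) b r (tet r)))
  where
  R = 2 * (b * suc (size bs)) + 2 * r + 2 * size bs + 3
  lhs : ∀ w s d g b r →
    2 * (b * suc s + w) + (2 * ((b + suc s) * suc r) + (b + suc s)) + (d + g)
    ≡ (2 * w + (2 * (s * r) + s) + d) + (g + (2 * (b * suc r) + b))
      + (2 * (b * suc s) + 2 * r + 2 * s + 3)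
  lhs = solve-∀
  rhs : ∀ s b r t → (s * s + (r * r + r) + t) + (b * b + (suc r * suc r + suc r))
      + (2 * (b * suc s) + 2 * r + 2 * s + 3)
    ≡ (b + suc s) * (b + suc s) + (suc r * suc r + suc r) + (suc r * suc (suc r) + t)
  rhs = solve-∀

-- Run sequences of defect zero

-- Entries are counted from the right, as in b_k ∷ … ∷ b_1 ∷ []: each b_j is j − 1 + o or j + o,
-- the larger value occurring exactly l times.
data Layout (o : ℕ) : ℕ → ℕ → List ℕ → Set where
  []    : Layout o 0 0 []
  short : ∀ {k l bs} → Layout o k l bs → Layout o (suc k) l (o + k ∷ bs)
  long  : ∀ {k l bs} → Layout o k l bs → Layout o (suc k) (suc l) (suc (o + k) ∷ bs)

layouts : ℕ → ℕ → ℕ → List (List ℕ)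
layouts o zero    zero    = [] ∷ []
layouts o zero    (suc l) = []
layouts o (suc k) zero    = map (o + k ∷_) (layouts o k zero)
layouts o (suc k) (suc l) = map (suc (o + k) ∷_) (layouts o k l) ++ map (o + k ∷_) (layouts o k (suc l))

∈-layouts⁺ : ∀ {o k l bs} → Layout o k l bs → bs ∈ layouts o k l
∈-layouts⁺ []                  = here refl
∈-layouts⁺ {l = zero}  (short h) = ∈-map⁺ _ (∈-layouts⁺ h)
∈-layouts⁺ {l = suc l} (short h) = ∈-++⁺ʳ _ (∈-map⁺ _ (∈-layouts⁺ h))
∈-layouts⁺ (long h)            = ∈-++⁺ˡ (∈-map⁺ _ (∈-layouts⁺ h))

∈-layouts⁻ : ∀ o k l {bs} → bs ∈ layouts o k l → Layout o k l bs
∈-layouts⁻ o zero    zero    (here refl) = []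
∈-layouts⁻ o (suc k) zero    bs∈ with ∈-map⁻ _ bs∈
... | _ , bs′∈ , refl = short (∈-layouts⁻ o k zero bs′∈)
∈-layouts⁻ o (suc k) (suc l) bs∈ with ∈-++⁻ (map (suc (o + k) ∷_) (layouts o k l)) bs∈
... | inj₁ p with ∈-map⁻ _ p
...   | _ , bs′∈ , refl = long (∈-layouts⁻ o k l bs′∈)
∈-layouts⁻ o (suc k) (suc l) bs∈ | inj₂ p with ∈-map⁻ _ p
...   | _ , bs′∈ , refl = short (∈-layouts⁻ o k (suc l) bs′∈)

layouts-unique : ∀ o k l → Unique (layouts o k l)
layouts-unique o zero    zero    = All.[] ∷ []
layouts-unique o zero    (suc l) = []
layouts-unique o (suc k) zero    = Unique.map⁺ ∷-injectiveʳ (layouts-unique o k zero)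
layouts-unique o (suc k) (suc l) = Unique.++⁺
  (Unique.map⁺ ∷-injectiveʳ (layouts-unique o k l))
  (Unique.map⁺ ∷-injectiveʳ (layouts-unique o k (suc l)))
  λ (p , q) → disjoint (∈-map⁻ _ p) (∈-map⁻ _ q)
  where
  disjoint : ∀ {bs} → ∃[ xs ] xs ∈ layouts o k l × bs ≡ suc (o + k) ∷ xs →
             ¬ (∃[ ys ] ys ∈ layouts o k (suc l) × bs ≡ o + k ∷ ys)
  disjoint (_ , _ , refl) (_ , _ , eq) = 1+n≢n (∷-injectiveˡ eq)

-- A layout is a choice of the l entries, out of k, that take the larger value; the recursion of
-- `layouts` is Pascal's rule.
length-layouts : ∀ o k l → length (layouts o k l) ≡ k C l
length-layouts o zero    zero    = refl
length-layouts o zero    (suc l) = refl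
length-layouts o (suc k) zero    = trans (length-map _ (layouts o k zero)) (length-layouts o k zero)
length-layouts o (suc k) (suc l) = begin
  length (map (suc (o + k) ∷_) (layouts o k l) ++ map (o + k ∷_) (layouts o k (suc l)))
    ≡⟨ length-++ (map (suc (o + k) ∷_) (layouts o k l)) ⟩
  length (map (suc (o + k) ∷_) (layouts o k l)) + length (map (o + k ∷_) (layouts o k (suc l)))
    ≡⟨ cong₂ _+_ (length-map _ (layouts o k l)) (length-map _ (layouts o k (suc l))) ⟩
  length (layouts o k l) + length (layouts o k (suc l))
    ≡⟨ cong₂ _+_ (length-layouts o k l) (length-layouts o k (suc l)) ⟩
  k C l + k C suc l
    ≡⟨ nCk+nC[k+1]≡[n+1]C[k+1] k l ⟩
  suc k C suc l ∎
  where open ≡-Reasoning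

Layout-exists : ∀ o {k l} → l ≤ k → ∃[ bs ] Layout o k l bs
Layout-exists o {zero}  z≤n       = _ , []
Layout-exists o {suc k} z≤n       = _ , short (proj₂ (Layout-exists o {k} z≤n))
Layout-exists o         (s≤s l≤k) = _ , long (proj₂ (Layout-exists o l≤k))

-- The size of a layout all of whose entries take the smaller value; each long entry adds one to it.
base : ℕ → ℕ → ℕ
base o zero    = 0
base o (suc k) = suc (o + k) + base o k

Layout-size : ∀ {o k l bs} → Layout o k l bs → size bs ≡ base o k + l
Layout-size []        = refl
Layout-size {o} {suc k} {l} (short {bs = bs} h) =
  trans (cong (λ s → o + k + suc s) (Layout-size h)) (eq (o + k) (base o k) l)
  where
  eq : ∀ x b l → x + suc (b + l) ≡ suc x + b + l
  eq = solve-∀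
Layout-size {o} {suc k} {suc l} (long {bs = bs} h) =
  trans (cong (λ s → suc (o + k) + suc s) (Layout-size h)) (eq (o + k) (base o k) l)
  where
  eq : ∀ x b l → suc x + suc (b + l) ≡ suc x + b + suc l
  eq = solve-∀

-- Either r runs with b_j ∈ {j, j + 1}, or r + 1 runs with b_j ∈ {j - 1, j}. In the second case one
-- run is left when r reaches 0, and nothing lies to its right, so no positive boundary term arises.
OptimalRuns : ℕ → List ℕ → Set
OptimalRuns r bs = (∃[ l ] Layout 1 r l bs) ⊎ (∃[ l ] Layout 0 (suc r) l bs)

defect≡0⁺ : ∀ {r bs} → OptimalRuns r bs → defect bs r ≡ 0
defect≡0⁺ {zero}  (inj₁ (_ , []))             = refl
defect≡0⁺ {zero}  (inj₂ (_ , short []))       = refl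
defect≡0⁺ {zero}  (inj₂ (_ , long []))        = refl
defect≡0⁺ {suc r} (inj₁ (_ , short h))        = cong₂ _+_ (defect≡0⁺ {r} (inj₁ (_ , h))) (gap-lower r)
defect≡0⁺ {suc r} (inj₁ (_ , long h))         = cong₂ _+_ (defect≡0⁺ {r} (inj₁ (_ , h))) (gap-upper r)
defect≡0⁺ {suc r} (inj₂ (_ , short h))        = cong₂ _+_ (defect≡0⁺ {r} (inj₂ (_ , h))) (gap-lower r)
defect≡0⁺ {suc r} (inj₂ (_ , long h))         = cong₂ _+_ (defect≡0⁺ {r} (inj₂ (_ , h))) (gap-upper r)

-- Every term of the defect must vanish. Each gap leaves two values for its run, and the boundary
-- terms exclude running out of runs while r is positive as well as having two or more runs left at
-- r = 0.
defect≡0⁻ : ∀ bs r → defect bs r ≡ 0 → OptimalRuns r bs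
defect≡0⁻ []           zero    _  = inj₁ (_ , [])
-- The boundary term `2 * size (c ∷ bs)` is positive, because a run contains at least its 0.
defect≡0⁻ (b ∷ c ∷ bs) zero    eq = ⊥-elim (1+n≢0 (trans (sym (+-suc c (size bs)))
  (m+n≡0⇒m≡0 (c + suc (size bs))
    (m+n≡0⇒n≡0 (gap b 0) (m+n≡0⇒n≡0 (defect (c ∷ bs) 0) eq)))))
defect≡0⁻ (b ∷ [])     zero    eq with gap≡0 b 0 (m+n≡0⇒m≡0 (gap b 0) eq)
... | inj₁ refl = inj₂ (_ , short [])
... | inj₂ refl = inj₂ (_ , long [])
defect≡0⁻ (b ∷ bs)     (suc r) eq
  with gap≡0 b (suc r) (m+n≡0⇒n≡0 (defect bs r) eq) | defect≡0⁻ bs r (m+n≡0⇒m≡0 (defect bs r) eq)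
... | inj₁ refl | inj₁ (_ , h) = inj₁ (_ , short h)
... | inj₁ refl | inj₂ (_ , h) = inj₂ (_ , short h)
... | inj₂ refl | inj₁ (_ , h) = inj₁ (_ , long h)
... | inj₂ refl | inj₂ (_ , h) = inj₂ (_ , long h)

-- Lehmer codes of permutations

χ : ∀ {P : Set} → Dec P → ℕ
χ P? = if does P? then 1 else 0

χ-×-dec : ∀ {P Q : Set} (P? : Dec P) (Q? : Dec Q) → χ (P? ×-dec Q?) ≡ χ P? * χ Q?
χ-×-dec P? Q? with does P? | does Q?
... | true  | true  = refl
... | true  | false = refl
... | false | _     = refl

length-filter-tabulate : ∀ {A : Set} {P : Pred A 0ℓ} (P? : Decidable P) {n} (f : Fin n → A) →
  length (filter P? (tabulate f)) ≡ ∑ (λ i → χ (P? (f i)))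
length-filter-tabulate P? {zero}  f = refl
length-filter-tabulate P? {suc n} f with does (P? (f zero))
... | true  = cong suc (length-filter-tabulate P? (f ∘ suc))
... | false = length-filter-tabulate P? (f ∘ suc)

length-filter-cartesianProduct : ∀ {A B : Set} {P : Pred (A × B) 0ℓ} (P? : Decidable P)
  {m n} (f : Fin m → A) (g : Fin n → B) →
  length (filter P? (cartesianProduct (tabulate f) (tabulate g)))
    ≡ ∑ (λ i → ∑ (λ j → χ (P? (f i , g j))))
length-filter-cartesianProduct P? {zero}  f g = refl
length-filter-cartesianProduct P? {suc m} f g = begin
  length (filter P? (row ++ rows))
    ≡⟨ cong length (filter-++ P? row rows) ⟩
  length (filter P? row ++ filter P? rows)
    ≡⟨ length-++ (filter P? row) ⟩
  length (filter P? row) + length (filter P? rows)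
    ≡⟨ cong₂ _+_ (trans (cong (length ∘ filter P?) (map-tabulate g (f zero ,_)))
                        (length-filter-tabulate P? (λ j → f zero , g j)))
                 (length-filter-cartesianProduct P? (f ∘ suc) g) ⟩
  _ ∎
  where
  open ≡-Reasoning
  row  = map (f zero ,_) (tabulate g)
  rows = cartesianProduct (tabulate (f ∘ suc)) (tabulate g)

lt : ℕ → ℕ → ℕ
lt a b = χ (a <? b)

lt-cong : ∀ {a b c d} → (a < b ⇔ c < d) → lt a b ≡ lt c d
lt-cong {a} {b} {c} {d} a<b⇔c<d =
  cong (if_then 1 else 0) (does-⇔ a<b⇔c<d (a <? b) (c <? d))

lt-true : ∀ {a b} → a < b → lt a b ≡ 1
lt-true {a} {b} a<b = cong (if_then 1 else 0) (dec-true (a <? b) a<b)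

lt-false : ∀ {a b} → ¬ a < b → lt a b ≡ 0
lt-false {a} {b} a≮b = cong (if_then 1 else 0) (dec-false (a <? b) a≮b)

-- As a double sum of products of indicators, the count can be reindexed, split and summed in either
-- order.
inversions : ∀ {m n} → (Fin m → Fin n) → ℕ
inversions f = ∑ (λ i → ∑ (λ j → lt (toℕ i) (toℕ j) * lt (toℕ (f j)) (toℕ (f i))))

∑∑-cong : ∀ {m n} {f g : Fin m → Fin n → ℕ} → (∀ i j → f i j ≡ g i j) →
          ∑ (λ i → ∑ (f i)) ≡ ∑ (λ i → ∑ (g i))
∑∑-cong eq = sum-cong-≗ (λ i → sum-cong-≗ (eq i))

inv≡inversions : ∀ {n} (π : Permutation′ n) → inv π ≡ inversions (π ⟨$⟩ʳ_)
inv≡inversions π = trans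
  (length-filter-cartesianProduct
    (λ (i , j) → (i Fin.<? j) ×-dec ((π ⟨$⟩ʳ j) Fin.<? (π ⟨$⟩ʳ i))) id id)
  (∑∑-cong λ i j → χ-×-dec (i Fin.<? j) ((π ⟨$⟩ʳ j) Fin.<? (π ⟨$⟩ʳ i)))

punchIn-mono-< : ∀ {n} a {x y : Fin n} → x Fin.< y → punchIn a x Fin.< punchIn a y
punchIn-mono-< a {x} {y} x<y = ≰⇒> (λ le → <⇒≱ x<y (Fin.punchIn-cancel-≤ a y x le))

punchIn-cancel-< : ∀ {n} a {x y : Fin n} → punchIn a x Fin.< punchIn a y → x Fin.< y
punchIn-cancel-< a {x} {y} lt = ≰⇒> (λ le → <⇒≱ lt (Fin.punchIn-mono-≤ a y x le))

punchIn-< : ∀ {n} (a : Fin (suc n)) {x} → toℕ x < toℕ a → toℕ (punchIn a x) ≡ toℕ x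
punchIn-< (suc a) {zero}  _         = refl
punchIn-< (suc a) {suc x} (s≤s x<a) = cong suc (punchIn-< a x<a)

punchIn-≥ : ∀ {n} (a : Fin (suc n)) {x} → toℕ (punchIn a x) < toℕ a → toℕ x < toℕ a
punchIn-≥ (suc a) {zero}  _         = s≤s z≤n
punchIn-≥ (suc a) {suc x} (s≤s lt)  = s≤s (punchIn-≥ a lt)

-- `punchIn a` omits the value a alone, so each value below a is hit exactly once.
∑-punchIn : ∀ {n} (a : Fin (suc n)) → ∑ (λ j → lt (toℕ (punchIn a j)) (toℕ a)) ≡ toℕ a
∑-punchIn {n}     zero    = sum-replicate-zero n
∑-punchIn {suc n} (suc a) = cong suc (∑-punchIn a)

-- Every value below the first one occurs later, so the first value is itself the first code entry;
-- `remove zero` standardises the remaining values.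
lehmer : ∀ {n} → Permutation′ n → List ℕ
lehmer {zero}  π = []
lehmer {suc n} π = toℕ (π ⟨$⟩ʳ zero) ∷ lehmer (remove zero π)

-- Inversions with the first position are counted by `∑-punchIn`, reindexed along the remaining
-- permutation. All other inversions survive the removal because `punchIn a` preserves order.
sum-lehmer : ∀ {n} (π : Permutation′ n) → sum (lehmer π) ≡ inversions (π ⟨$⟩ʳ_)
sum-lehmer {zero}  π = refl
sum-lehmer {suc n} π = cong₂ _+_
  (begin
    toℕ a                                              ≡⟨ ∑-punchIn a ⟨
    ∑ (λ j → lt (toℕ (punchIn a j)) (toℕ a))           ≡⟨ sum-permute _ (remove zero π) ⟩
    ∑ (λ j → lt (toℕ (punchIn a (σ j))) (toℕ a))
      ≡⟨ sum-cong-≗ (λ j → trans (cong (λ x → lt (toℕ x) (toℕ a)) (sym (punchIn-permute π zero j)))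
                                 (sym (+-identityʳ _))) ⟩
    ∑ (λ j → lt (toℕ (π ⟨$⟩ʳ suc j)) (toℕ a) + 0) ∎)
  (trans (sum-lehmer (remove zero π)) (∑∑-cong λ i j → cong (lt (toℕ i) (toℕ j) *_)
    (trans (lt-cong (mk⇔ (punchIn-mono-< a) (punchIn-cancel-< a)))
           (cong₂ (λ x y → lt (toℕ x) (toℕ y))
             (sym (punchIn-permute π zero j)) (sym (punchIn-permute π zero i))))))
  where
  open ≡-Reasoning
  a = π ⟨$⟩ʳ zero
  σ = remove zero π ⟨$⟩ʳ_

inv≡sum-lehmer : ∀ {n} (π : Permutation′ n) → inv π ≡ sum (lehmer π)
inv≡sum-lehmer π = trans (inv≡inversions π) (sym (sum-lehmer π))

length-lehmer : ∀ {n} (π : Permutation′ n) → length (lehmer π) ≡ n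
length-lehmer {zero}  π = refl
length-lehmer {suc n} π = cong suc (length-lehmer (remove zero π))

lehmer-bounded : ∀ {n} (π : Permutation′ n) → Bounded (lehmer π)
lehmer-bounded {zero}  π = tt
lehmer-bounded {suc n} π =
  subst (toℕ (π ⟨$⟩ʳ zero) ≤_) (sym (length-lehmer (remove zero π))) (Fin.toℕ≤pred[n] (π ⟨$⟩ʳ zero))
  , lehmer-bounded (remove zero π)

lehmer-cong : ∀ {n} {π τ : Permutation′ n} → π ≈ τ → lehmer π ≡ lehmer τ
lehmer-cong {zero}          π≈τ = refl
lehmer-cong {suc n} {π} {τ} π≈τ = cong₂ _∷_ (cong toℕ (π≈τ zero)) (lehmer-cong λ j →
  Fin.punchIn-injective (π ⟨$⟩ʳ zero) _ _ (begin
    punchIn (π ⟨$⟩ʳ zero) (remove zero π ⟨$⟩ʳ j) ≡⟨ punchIn-permute π zero j ⟨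
    π ⟨$⟩ʳ suc j                                 ≡⟨ π≈τ (suc j) ⟩
    τ ⟨$⟩ʳ suc j                                 ≡⟨ punchIn-permute τ zero j ⟩
    punchIn (τ ⟨$⟩ʳ zero) (remove zero τ ⟨$⟩ʳ j)
      ≡⟨ cong (λ a → punchIn a (remove zero τ ⟨$⟩ʳ j)) (π≈τ zero) ⟨
    punchIn (π ⟨$⟩ʳ zero) (remove zero τ ⟨$⟩ʳ j) ∎))
  where open ≡-Reasoning

lehmer-injective : ∀ {n} {π τ : Permutation′ n} → lehmer π ≡ lehmer τ → π ≈ τ
lehmer-injective {suc n} eq zero = Fin.toℕ-injective (∷-injectiveˡ eq)
lehmer-injective {suc n} {π} {τ} eq (suc j) = begin
  π ⟨$⟩ʳ suc j                                 ≡⟨ punchIn-permute π zero j ⟩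
  punchIn (π ⟨$⟩ʳ zero) (remove zero π ⟨$⟩ʳ j)
    ≡⟨ cong₂ punchIn (Fin.toℕ-injective (∷-injectiveˡ eq))
                     (lehmer-injective {π = remove zero π} {τ = remove zero τ} (∷-injectiveʳ eq) j) ⟩
  punchIn (τ ⟨$⟩ʳ zero) (remove zero τ ⟨$⟩ʳ j) ≡⟨ punchIn-permute τ zero j ⟨
  τ ⟨$⟩ʳ suc j                                 ∎
  where open ≡-Reasoning

-- A code is realised by inserting its head in front of a permutation that realises its tail.
lehmer-surjective : ∀ n c → length c ≡ n → Bounded c → ∃[ π ] lehmer {n} π ≡ c
lehmer-surjective zero    []      eq v = idₚ , refl
lehmer-surjective (suc n) (a ∷ c) eq (a≤ , v) with lehmer-surjective n c (suc-injective eq) v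
... | σ , eq′ = insert zero i σ
              , cong₂ _∷_ (Fin.toℕ-fromℕ< (s≤s a≤n))
                          (trans (lehmer-cong (remove-insert zero i σ)) eq′)
  where
  a≤n : a ≤ n
  a≤n = subst (a ≤_) (suc-injective eq) a≤
  i = fromℕ< (s≤s a≤n)

-- The common target of the three symmetries, with 3 and 2 adjacent. It says that nothing after a
-- descent lies below its lower end, which is a condition on the code entry at that end.
Avoids32-1 : ∀ {N} → Pred (Permutation′ N) 0ℓ
Avoids32-1 {N} π = ¬ (∃[ i ] ∃[ j ] ∃[ k ]
  toℕ j ≡ suc (toℕ i) × j Fin.< k ×
  (π ⟨$⟩ʳ j) Fin.< (π ⟨$⟩ʳ i) × (π ⟨$⟩ʳ k) Fin.< (π ⟨$⟩ʳ j))

module _ {n} (π : Permutation′ (suc n)) where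

  private
    a = π ⟨$⟩ʳ zero
    σ = remove zero π

  remove-mono-< : ∀ {i j} → (σ ⟨$⟩ʳ i) Fin.< (σ ⟨$⟩ʳ j) → (π ⟨$⟩ʳ suc i) Fin.< (π ⟨$⟩ʳ suc j)
  remove-mono-< {i} {j} lt =
    subst₂ Fin._<_ (sym (punchIn-permute π zero i)) (sym (punchIn-permute π zero j)) (punchIn-mono-< a lt)

  remove-cancel-< : ∀ {i j} → (π ⟨$⟩ʳ suc i) Fin.< (π ⟨$⟩ʳ suc j) → (σ ⟨$⟩ʳ i) Fin.< (σ ⟨$⟩ʳ j)
  remove-cancel-< {i} {j} lt =
    punchIn-cancel-< a (subst₂ Fin._<_ (punchIn-permute π zero i) (punchIn-permute π zero j) lt)

avoids⇒drops : ∀ {n} (π : Permutation′ n) → Avoids32-1 π → DropsToZero (lehmer π)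
avoids⇒drops {zero}        π av = tt
avoids⇒drops {suc zero}    π av = tt
avoids⇒drops {suc (suc n)} π av = head , avoids⇒drops σ tail
  where
  a = π ⟨$⟩ʳ zero
  σ = remove zero π
  b = σ ⟨$⟩ʳ zero
  -- The position of the least remaining value: if b is not that value, it serves as the letter 1
  -- after the drop from a to b.
  k = σ ⟨$⟩ˡ zero

  head : toℕ b < toℕ a → toℕ b ≡ 0
  head b<a with toℕ b in eq
  ... | zero  = refl
  ... | suc x = ⊥-elim (av (zero , suc zero , suc k , refl , s≤s 0<k , π₁<π₀ , remove-mono-< π σₖ<σ₀))
    where
    σₖ<σ₀ : (σ ⟨$⟩ʳ k) Fin.< b
    σₖ<σ₀ = subst₂ _<_ (sym (cong toℕ (inverseʳ σ {zero}))) (sym eq) (s≤s z≤n)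
    0<k : 0 < toℕ k
    0<k with k in k≡
    ... | suc _ = s≤s z≤n
    ... | zero  = ⊥-elim (<-irrefl (cong (λ i → toℕ (σ ⟨$⟩ʳ i)) k≡) σₖ<σ₀)
    -- `punchIn a` does not move values below a, so b < a makes the second value of `π` equal to b.
    π₁<π₀ : (π ⟨$⟩ʳ suc zero) Fin.< a
    π₁<π₀ = subst (_< toℕ a)
      (sym (trans (cong toℕ (punchIn-permute π zero zero))
                  (trans (punchIn-< a (subst (_< toℕ a) (sym eq) b<a)) eq)))
      b<a

  tail : Avoids32-1 σ
  tail (i , j , k , j≡ , j<k , lt , lt′) =
    av (suc i , suc j , suc k , cong suc j≡ , s≤s j<k , remove-mono-< π lt , remove-mono-< π lt′)

-- A descent at the front forces the second code entry to be 0, and then the second value is the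
-- least of all, so that no letter 1 can follow.
drops⇒avoids : ∀ {n} (π : Permutation′ n) → DropsToZero (lehmer π) → Avoids32-1 π
drops⇒avoids {suc (suc n)} π (head , _) (zero , suc zero , k , _ , _ , lt , lt′) =
  n≮0 (subst (toℕ (π ⟨$⟩ʳ k) <_) π₁≡0 lt′)
  where
  a = π ⟨$⟩ʳ zero
  b<a : toℕ (remove zero π ⟨$⟩ʳ zero) < toℕ a
  b<a = punchIn-≥ a (subst (Fin._< a) (punchIn-permute π zero zero) lt)
  π₁≡0 : toℕ (π ⟨$⟩ʳ suc zero) ≡ 0
  π₁≡0 = trans (cong toℕ (punchIn-permute π zero zero)) (trans (punchIn-< a b<a) (head b<a))
drops⇒avoids {suc (suc n)} π (_ , tail) (suc i , suc j , suc k , j≡ , s≤s j<k , lt , lt′) =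
  drops⇒avoids (remove zero π) tail
    (i , j , k , suc-injective j≡ , j<k , remove-cancel-< π lt , remove-cancel-< π lt′)
drops⇒avoids {suc zero} π _ (zero , zero , _ , () , _)
drops⇒avoids {suc (suc n)} π _ (zero , suc (suc _) , _ , () , _)

-- Symmetries

opposite-+ : ∀ {n} (i : Fin n) → toℕ (opposite i) + suc (toℕ i) ≡ n
opposite-+ i = trans (cong (_+ suc (toℕ i)) (Fin.opposite-prop i)) (m∸n+n≡m (Fin.toℕ<n i))

opposite-mono-< : ∀ {n} {i j : Fin n} → i Fin.< j → opposite j Fin.< opposite i
opposite-mono-< {n} {i} {j} i<j = subst₂ _<_ (sym (Fin.opposite-prop j)) (sym (Fin.opposite-prop i))
  (∸-monoʳ-< (s≤s i<j) (Fin.toℕ<n j))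

opposite-cancel-< : ∀ {n} {i j : Fin n} → opposite i Fin.< opposite j → j Fin.< i
opposite-cancel-< {i = i} {j} lt =
  subst₂ Fin._<_ (Fin.opposite-involutive j) (Fin.opposite-involutive i) (opposite-mono-< lt)

lt-opposite : ∀ {n} (i j : Fin n) → lt (toℕ (opposite i)) (toℕ (opposite j)) ≡ lt (toℕ j) (toℕ i)
lt-opposite i j = lt-cong (mk⇔ (opposite-cancel-< {i = i} {j}) (opposite-mono-< {i = j} {i}))

opposite-adjacent : ∀ {n} {i j : Fin n} → toℕ j ≡ suc (toℕ i) → toℕ (opposite i) ≡ suc (toℕ (opposite j))
opposite-adjacent {n} {i} {j} j≡ = +-cancelʳ-≡ (suc (toℕ i)) _ _ (begin
  toℕ (opposite i) + suc (toℕ i)       ≡⟨ opposite-+ i ⟩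
  n                                    ≡⟨ opposite-+ j ⟨
  toℕ (opposite j) + suc (toℕ j)       ≡⟨ cong (λ x → toℕ (opposite j) + suc x) j≡ ⟩
  toℕ (opposite j) + suc (suc (toℕ i)) ≡⟨ +-suc (toℕ (opposite j)) _ ⟩
  suc (toℕ (opposite j)) + suc (toℕ i) ∎)
  where open ≡-Reasoning

module _ {n : ℕ} where

  -- `∘ₚ` applies its left factor first, so `reverse` acts on the values here and on the positions
  -- in `reversal`.
  complement : Permutation′ n → Permutation′ n
  complement π = π ∘ₚ reverse

  reversal : Permutation′ n → Permutation′ n
  reversal π = reverse ∘ₚ π

  half-turn : Permutation′ n → Permutation′ n
  half-turn = reversal ∘ complement

  -- Each pair of positions is an inversion of exactly one of the two permutations.
  inversions-complement : (π : Permutation′ n) →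
    inversions (π ⟨$⟩ʳ_) + inversions (complement π ⟨$⟩ʳ_)
      ≡ ∑ (λ (i : Fin n) → ∑ (λ (j : Fin n) → lt (toℕ i) (toℕ j)))
  inversions-complement π = begin
    inversions (π ⟨$⟩ʳ_) + inversions (complement π ⟨$⟩ʳ_)
      ≡⟨ ∑-distrib-+ (λ i → ∑ (f i)) (λ i → ∑ (g i)) ⟨
    ∑ (λ i → ∑ (f i) + ∑ (g i))
      ≡⟨ sum-cong-≗ (λ i → sym (∑-distrib-+ (f i) (g i))) ⟩
    ∑ (λ i → ∑ (λ j → f i j + g i j))
      ≡⟨ ∑∑-cong pair ⟩
    _ ∎
    where
    open ≡-Reasoning
    p = λ i → toℕ (π ⟨$⟩ʳ i)
    f g : Fin n → Fin n → ℕ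
    f i j = lt (toℕ i) (toℕ j) * lt (p j) (p i)
    g i j = lt (toℕ i) (toℕ j) * lt (toℕ (opposite (π ⟨$⟩ʳ j))) (toℕ (opposite (π ⟨$⟩ʳ i)))
    pair : ∀ i j → f i j + g i j ≡ lt (toℕ i) (toℕ j)
    pair i j = trans (sym (*-distribˡ-+ (lt (toℕ i) (toℕ j)) _ _))
      (trans (cong (λ x → lt (toℕ i) (toℕ j) * (lt (p j) (p i) + x)) (lt-opposite (π ⟨$⟩ʳ j) (π ⟨$⟩ʳ i))) total)
      where
      total : lt (toℕ i) (toℕ j) * (lt (p j) (p i) + lt (p i) (p j)) ≡ lt (toℕ i) (toℕ j)
      total with <-cmp (p i) (p j)
      ... | tri< lt _ gt rewrite lt-true lt | lt-false gt = *-identityʳ _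
      ... | tri> gt _ lt rewrite lt-true lt | lt-false gt = *-identityʳ _
      -- Equal values force equal positions, and there the position indicator is 0.
      ... | tri≈ ≮ eq ≯ with Injection.injective (↔⇒↣ π) (Fin.toℕ-injective eq)
      ...   | refl rewrite lt-false (<-irrefl {toℕ i} refl) = refl

  -- Both indicators have their arguments exchanged. Reindexing the positions and swapping the two
  -- summations restores the original sum.
  inversions-half-turn : (π : Permutation′ n) →
    inversions (half-turn π ⟨$⟩ʳ_) ≡ inversions (π ⟨$⟩ʳ_)
  inversions-half-turn π = begin
    ∑ (λ i → ∑ (λ j → lt (toℕ i) (toℕ j)
                     * lt (toℕ (opposite (π ⟨$⟩ʳ opposite j))) (toℕ (opposite (π ⟨$⟩ʳ opposite i)))))
      ≡⟨ ∑∑-cong (λ i j → cong₂ _*_ (sym (lt-opposite j i))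
                                    (lt-opposite (π ⟨$⟩ʳ opposite j) (π ⟨$⟩ʳ opposite i))) ⟩
    ∑ (λ i → ∑ (λ j → h (opposite i) (opposite j)))
      ≡⟨ sum-cong-≗ (λ i → sym (sum-permute (h (opposite i)) reverse)) ⟩
    ∑ (λ i → ∑ (h (opposite i)))
      ≡⟨ sum-permute (λ i → ∑ (h i)) reverse ⟨
    ∑ (λ i → ∑ (h i))
      ≡⟨ ∑-comm h ⟩
    inversions (π ⟨$⟩ʳ_) ∎
    where
    open ≡-Reasoning
    h : Fin n → Fin n → ℕ
    h i j = lt (toℕ j) (toℕ i) * lt (toℕ (π ⟨$⟩ʳ i)) (toℕ (π ⟨$⟩ʳ j))

∑∑lt : ∀ n → ∑ (λ (i : Fin n) → ∑ (λ (j : Fin n) → lt (toℕ i) (toℕ j))) ≡ n C 2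
∑∑lt zero    = refl
∑∑lt (suc n) = begin
  ∑ (λ (j : Fin n) → 1) + ∑ (λ (i : Fin n) → ∑ (λ (j : Fin n) → lt (toℕ i) (toℕ j)))
    ≡⟨ cong₂ _+_ (ones n) (∑∑lt n) ⟩
  n + n C 2        ≡⟨ cong (_+ n C 2) (nC1≡n n) ⟨
  n C 1 + n C 2    ≡⟨ nCk+nC[k+1]≡[n+1]C[k+1] n 1 ⟩
  suc n C 2        ∎
  where
  open ≡-Reasoning
  ones : ∀ n → ∑ (λ (j : Fin n) → 1) ≡ n
  ones zero    = refl
  ones (suc n) = cong suc (ones n)

module _ {n : ℕ} where

  inv-cong : {π τ : Permutation′ n} → π ≈ τ → inv π ≡ inv τ
  inv-cong {π} {τ} π≈τ = trans (inv≡inversions π) (trans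
    (∑∑-cong λ i j → cong₂ (λ x y → lt (toℕ i) (toℕ j) * lt (toℕ x) (toℕ y)) (π≈τ j) (π≈τ i))
    (sym (inv≡inversions τ)))

  inv-complement : (π : Permutation′ n) → inv π + inv (complement π) ≡ n C 2
  inv-complement π = trans (cong₂ _+_ (inv≡inversions π) (inv≡inversions (complement π)))
    (trans (inversions-complement π) (∑∑lt n))

  inv-half-turn : (π : Permutation′ n) → inv (half-turn π) ≡ inv π
  inv-half-turn π = trans (inv≡inversions (half-turn π)) (trans
    (inversions-half-turn π) (sym (inv≡inversions π)))

  complement-involutive : (π : Permutation′ n) → complement (complement π) ≈ π
  complement-involutive π i = Fin.opposite-involutive _

  reversal-involutive : (π : Permutation′ n) → reversal (reversal π) ≈ π
  reversal-involutive π i = cong (π ⟨$⟩ʳ_) (Fin.opposite-involutive i)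

  half-turn-involutive : (π : Permutation′ n) → half-turn (half-turn π) ≈ π
  half-turn-involutive π i = trans (Fin.opposite-involutive _) (reversal-involutive π i)

  -- Reversal is the half-turn of the complement, and the half-turn preserves `inv`.
  inv-reversal : (π : Permutation′ n) → inv π + inv (reversal π) ≡ n C 2
  inv-reversal π = trans (cong (λ x → inv π + x) (trans
      (inv-cong {reversal π} {half-turn (complement π)} (λ i → sym (Fin.opposite-involutive _)))
      (inv-half-turn (complement π))))
    (inv-complement π)

  3-21⇔1-23 : (π : Permutation′ n) → Avoids3-21 π ⇔ Avoids1-23 (complement π)
  3-21⇔1-23 π = mk⇔
    (λ av (i , j , k , i<j , k≡ , lt , lt′) →
      av (i , j , k , i<j , k≡ , opposite-cancel-< lt , opposite-cancel-< lt′))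
    (λ av (i , j , k , i<j , k≡ , lt , lt′) →
      av (i , j , k , i<j , k≡ , opposite-mono-< lt , opposite-mono-< lt′))

  12-3⇔32-1 : (π : Permutation′ n) → Avoids12-3 π ⇔ Avoids32-1 (complement π)
  12-3⇔32-1 π = mk⇔
    (λ av (i , j , k , j≡ , j<k , lt , lt′) →
      av (i , j , k , j≡ , j<k , opposite-cancel-< lt , opposite-cancel-< lt′))
    (λ av (i , j , k , j≡ , j<k , lt , lt′) →
      av (i , j , k , j≡ , j<k , opposite-mono-< lt , opposite-mono-< lt′))

  -- Reversing the positions exchanges the outer letters and moves the adjacent pair from the end of
  -- the pattern to its start.
  1-23⇔32-1 : (π : Permutation′ n) → Avoids1-23 π ⇔ Avoids32-1 (reversal π)
  1-23⇔32-1 π = mk⇔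
    (λ av (i , j , k , j≡ , j<k , lt , lt′) → av
      (opposite k , opposite j , opposite i , opposite-mono-< j<k , opposite-adjacent j≡ , lt′ , lt))
    (λ av (i , j , k , i<j , k≡ , lt , lt′) → av
      (opposite k , opposite j , opposite i , opposite-adjacent k≡ , opposite-mono-< i<j
      , subst₂ Fin._<_ (sym (reversal-involutive π j)) (sym (reversal-involutive π k)) lt′
      , subst₂ Fin._<_ (sym (reversal-involutive π i)) (sym (reversal-involutive π j)) lt))

  3-21⇔32-1 : (π : Permutation′ n) → Avoids3-21 π ⇔ Avoids32-1 (half-turn π)
  3-21⇔32-1 π = mk⇔
    (Equivalence.to (1-23⇔32-1 (complement π)) ∘ Equivalence.to (3-21⇔1-23 π))
    (Equivalence.from (3-21⇔1-23 π) ∘ Equivalence.from (1-23⇔32-1 (complement π)))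

  Avoids32-1-resp-≈ : {π τ : Permutation′ n} → π ≈ τ → Avoids32-1 π → Avoids32-1 τ
  Avoids32-1-resp-≈ π≈τ av (i , j , k , j≡ , j<k , lt , lt′) = av (i , j , k , j≡ , j<k
    , subst₂ Fin._<_ (sym (π≈τ j)) (sym (π≈τ i)) lt , subst₂ Fin._<_ (sym (π≈τ k)) (sym (π≈τ j)) lt′)

  𝒵-resp-≈ : {π τ : Permutation′ n} → π ≈ τ → 𝒵 Avoids32-1 π → 𝒵 Avoids32-1 τ
  𝒵-resp-≈ {π} {τ} π≈τ (av , max) = Avoids32-1-resp-≈ {π} {τ} π≈τ av
    , λ υ avυ → ≤-trans (max υ avυ) (≤-reflexive (inv-cong {π} {τ} π≈τ))

  -- An involution `φ` that turns `S` into `Avoids32-1` also transports extremal sets and their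
  -- cardinalities. `Preserving` is for symmetries that fix `inv`, `Reversing` for those that
  -- reflect it and so exchange minimum and maximum.
  module Transfer
    (φ : Permutation′ n → Permutation′ n)
    (φ-cong : ∀ {π τ} → π ≈ τ → φ π ≈ φ τ)
    (φ-involutive : ∀ π → φ (φ π) ≈ π)
    {S : Pred (Permutation′ n) 0ℓ}
    (S⇔ : ∀ π → S π ⇔ Avoids32-1 (φ π))
    where

    to-S : ∀ {τ} → Avoids32-1 τ → S (φ τ)
    to-S {τ} av = Equivalence.from (S⇔ (φ τ))
      (Avoids32-1-resp-≈ {τ} {φ (φ τ)} (λ i → sym (φ-involutive τ i)) av)

    card : ∀ {X : Pred (Permutation′ n) 0ℓ} → (∀ π → X π ⇔ 𝒵 Avoids32-1 (φ π)) →
           ∀ {k} → Card (𝒵 Avoids32-1) k → Card X k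
    card X⇔ β = record
      { to        = λ i → φ (proj₁ (to i)) , Equivalence.from (X⇔ _)
          (𝒵-resp-≈ {proj₁ (to i)} {φ (φ (proj₁ (to i)))} (λ x → sym (φ-involutive _ x)) (proj₂ (to i)))
      ; cong      = λ eq → φ-cong (Bijection.cong β eq)
      ; bijective =
          (λ {i} {j} eq → injective (λ x → trans (sym (φ-involutive _ x))
            (trans (φ-cong eq x) (φ-involutive _ x))))
        , λ (π , Xπ) → let (i , hit) = surjective (φ π , Equivalence.to (X⇔ π) Xπ) in
            i , λ z≡i x → trans (φ-cong (hit z≡i) x) (φ-involutive π x)
      }
      where
      open Bijection {From = setoid (Fin _)} {To = subsetSetoid (𝒵 Avoids32-1)} β
        using (to; injective; surjective)

    module Preserving (inv-φ : ∀ π → inv (φ π) ≡ inv π) where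

      𝒵⇔ : ∀ π → 𝒵 S π ⇔ 𝒵 Avoids32-1 (φ π)
      𝒵⇔ π = mk⇔
        (λ (s , max) → Equivalence.to (S⇔ π) s
          , λ τ av → subst₂ _≤_ (inv-φ τ) (sym (inv-φ π)) (max (φ τ) (to-S {τ} av)))
        (λ (av , max) → Equivalence.from (S⇔ π) av
          , λ τ s → subst₂ _≤_ (inv-φ τ) (inv-φ π) (max (φ τ) (Equivalence.to (S⇔ τ) s)))

    module Reversing {C : ℕ} (inv-φ : ∀ π → inv π + inv (φ π) ≡ C) where

      antitone : ∀ {π τ} → inv π ≤ inv τ → inv (φ τ) ≤ inv (φ π)
      antitone {π} {τ} le = +-cancelˡ-≤ (inv π) _ _ (begin
        inv π + inv (φ τ) ≤⟨ +-monoˡ-≤ _ le ⟩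
        inv τ + inv (φ τ) ≡⟨ trans (inv-φ τ) (sym (inv-φ π)) ⟩
        inv π + inv (φ π) ∎)
        where open ≤-Reasoning

      inv-φφ : ∀ π → inv (φ (φ π)) ≡ inv π
      inv-φφ π = inv-cong {φ (φ π)} {π} (φ-involutive π)

      𝒴⇔ : ∀ π → 𝒴 S π ⇔ 𝒵 Avoids32-1 (φ π)
      𝒴⇔ π = mk⇔
        (λ (s , min) → Equivalence.to (S⇔ π) s
          , λ τ av → subst (_≤ inv (φ π)) (inv-φφ τ) (antitone {π} {φ τ} (min (φ τ) (to-S {τ} av))))
        (λ (av , max) → Equivalence.from (S⇔ π) av
          , λ τ s → subst₂ _≤_ (inv-φφ π) (inv-φφ τ)
              (antitone {φ τ} {φ π} (max (φ τ) (Equivalence.to (S⇔ τ) s))))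

-- Counting the optimal permutations

lookup-injective : ∀ {A : Set} {xs : List A} → Unique xs →
  ∀ i j → lookup xs i ≡ lookup xs j → i ≡ j
lookup-injective (_ ∷ _)  zero    zero    _  = refl
lookup-injective (x∉ ∷ _) zero    (suc j) eq = ⊥-elim (All.lookup x∉ (∈-lookup j) eq)
lookup-injective (x∉ ∷ _) (suc i) zero    eq = ⊥-elim (All.lookup x∉ (∈-lookup i) (sym eq))
lookup-injective (_ ∷ u)  (suc i) (suc j) eq = cong suc (lookup-injective u i j eq)

-- Permutations up to `≈` correspond to their codes, so the positions in a duplicate-free list of
-- realised codes index the set.
card-by-lehmer : ∀ {n} {X : Pred (Permutation′ n) 0ℓ} {cs : List (List ℕ)} →
  Unique cs → (∀ π → X π ⇔ lehmer π ∈ cs) → (∀ {c} → c ∈ cs → ∃[ π ] lehmer {n} π ≡ c) →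
  Card X (length cs)
card-by-lehmer {n} {X} {cs} unique X⇔ realise = record
  { to        = λ i → perm i , Equivalence.from (X⇔ (perm i))
                  (subst (_∈ cs) (sym (lehmer-perm i)) (∈-lookup i))
  ; cong      = λ { refl _ → refl }
  ; bijective =
      (λ {i} {j} eq → lookup-injective unique i j
        (trans (sym (lehmer-perm i)) (trans (lehmer-cong {π = perm i} {perm j} eq) (lehmer-perm j))))
    , λ (π , Xπ) → let hit = Equivalence.to (X⇔ π) Xπ in
        index hit , λ { refl → lehmer-injective {π = perm (index hit)} {π}
          (trans (lehmer-perm (index hit)) (sym (lookup-index hit))) }
  }
  where
  perm : Fin (length cs) → Permutation′ n
  perm i = proj₁ (realise (∈-lookup {xs = cs} i))
  lehmer-perm : ∀ i → lehmer (perm i) ≡ lookup cs i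
  lehmer-perm i = proj₂ (realise (∈-lookup {xs = cs} i))

-- For fixed size and r, all terms of `weight-identity` other than the weight and the defect are
-- constant. Hence the weight is largest exactly where the defect vanishes.
weight-compare : ∀ {bs bs′ r} → size bs ≡ size bs′ → defect bs′ r ≡ 0 →
  2 * weight bs + defect bs r ≡ 2 * weight bs′
weight-compare {bs} {bs′} {r} size≡ defect≡0 = +-cancelʳ-≡ (2 * (s * r) + s) _ _ (begin
  2 * weight bs + defect bs r + (2 * (s * r) + s)   ≡⟨ swap (2 * weight bs) (defect bs r) _ ⟩
  2 * weight bs + (2 * (s * r) + s) + defect bs r   ≡⟨ weight-identity bs r ⟩
  s * s + (r * r + r) + tet r                       ≡⟨ cong (λ s → s * s + (r * r + r) + tet r) size≡ ⟩
  s′ * s′ + (r * r + r) + tet r                     ≡⟨ weight-identity bs′ r ⟨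
  2 * weight bs′ + (2 * (s′ * r) + s′) + defect bs′ r
    ≡⟨ cong (λ d → 2 * weight bs′ + (2 * (s′ * r) + s′) + d) defect≡0 ⟩
  2 * weight bs′ + (2 * (s′ * r) + s′) + 0          ≡⟨ +-identityʳ _ ⟩
  2 * weight bs′ + (2 * (s′ * r) + s′)              ≡⟨ cong (λ s → 2 * weight bs′ + (2 * (s * r) + s)) size≡ ⟨
  2 * weight bs′ + (2 * (s * r) + s)                ∎)
  where
  open ≡-Reasoning
  s  = size bs
  s′ = size bs′
  swap : ∀ a b c → a + b + c ≡ a + c + b
  swap = solve-∀

weight-maximal : ∀ {bs bs′ r} → size bs ≡ size bs′ → defect bs′ r ≡ 0 → weight bs ≤ weight bs′
weight-maximal {bs} {bs′} {r} size≡ defect≡0 = *-cancelˡ-≤ 2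
  (≤-trans (m≤m+n _ (defect bs r)) (≤-reflexive (weight-compare {bs} {bs′} size≡ defect≡0)))

weight-maximum⇒defect≡0 : ∀ {bs bs′ r} → size bs ≡ size bs′ → defect bs′ r ≡ 0 →
  weight bs ≡ weight bs′ → defect bs r ≡ 0
weight-maximum⇒defect≡0 {bs} {bs′} size≡ defect≡0 weight≡ = +-cancelˡ-≡ (2 * weight bs) _ 0
  (trans (weight-compare {bs} {bs′} size≡ defect≡0)
         (trans (cong (2 *_) (sym weight≡)) (sym (+-identityʳ _))))

-- One run sequence of defect 0 fixes the maximum: its weight bounds `inv` on the avoiders, and the
-- permutation with code `fill bs₀` attains it.
module Maximum {n r bs₀} (size₀ : size bs₀ ≡ n) (defect₀ : defect bs₀ r ≡ 0) where

  fill-perm : ∀ bs → size bs ≡ n → ∃[ π ] lehmer {n} π ≡ fill bs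
  fill-perm bs size≡n = lehmer-surjective n (fill bs)
    (trans (HasRuns-length (fill-HasRuns bs)) size≡n) (HasRuns-bounded (fill-HasRuns bs))

  fill-avoids : ∀ {bs} {π : Permutation′ n} → lehmer π ≡ fill bs → Avoids32-1 π
  fill-avoids {bs} {π} eq = drops⇒avoids π (subst DropsToZero (sym eq) (fill-drops bs))

  fill-inv : ∀ {bs} {π : Permutation′ n} → lehmer π ≡ fill bs → inv π ≡ weight bs
  fill-inv {bs} {π} eq = trans (inv≡sum-lehmer π) (trans (cong sum eq) (fill-sum bs))

  perm-runs : ∀ {π : Permutation′ n} → Avoids32-1 π → ∃[ bs ] lehmer π HasRuns bs × size bs ≡ n
  perm-runs {π} av with runs (lehmer π) (lehmer-bounded π) (avoids⇒drops π av)
  ... | bs , h = bs , h , trans (sym (HasRuns-length h)) (length-lehmer π)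

  inv-bound : ∀ {π : Permutation′ n} → Avoids32-1 π → inv π ≤ weight bs₀
  inv-bound {π} av with perm-runs {π} av
  ... | bs , h , size≡n = begin
    inv π          ≡⟨ inv≡sum-lehmer π ⟩
    sum (lehmer π) ≤⟨ HasRuns-sum h ⟩
    weight bs      ≤⟨ weight-maximal {bs} {bs₀} (trans size≡n (sym size₀)) defect₀ ⟩
    weight bs₀     ∎
    where open ≤-Reasoning

  𝒵⁺ : ∀ {bs} {π : Permutation′ n} → size bs ≡ n → defect bs r ≡ 0 → lehmer π ≡ fill bs →
       𝒵 Avoids32-1 π
  𝒵⁺ {bs} {π} size≡n defect≡0 eq = fill-avoids {bs} {π} eq , λ τ av → begin
    inv τ      ≤⟨ inv-bound {τ} av ⟩
    weight bs₀ ≤⟨ weight-maximal {bs₀} {bs} (trans size₀ (sym size≡n)) defect≡0 ⟩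
    weight bs  ≡⟨ fill-inv {bs} {π} eq ⟨
    inv π      ∎
    where open ≤-Reasoning

  witness : ∃[ π ] 𝒵 {n} Avoids32-1 π × inv π ≡ weight bs₀
  witness with fill-perm bs₀ size₀
  ... | π , eq = π , 𝒵⁺ {bs₀} {π} size₀ defect₀ eq , fill-inv {bs₀} {π} eq

  -- The chain `weight bs₀` ≤ `sum (lehmer π)` ≤ `weight bs` ≤ `weight bs₀` collapses. Its last link
  -- gives defect 0, its middle link makes every entry maximal.
  𝒵⁻ : ∀ {π : Permutation′ n} → 𝒵 Avoids32-1 π →
       ∃[ bs ] size bs ≡ n × defect bs r ≡ 0 × lehmer π ≡ fill bs
  𝒵⁻ {π} (av , max) with perm-runs {π} av | witness
  ... | bs , h , size≡n | τ , (avτ , _) , invτ = bs , size≡n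
      , weight-maximum⇒defect≡0 {bs} {bs₀} size≡ defect₀
          (≤-antisym weight≤ (≤-trans weight₀≤ (HasRuns-sum h)))
      , HasRuns-tight h (≤-antisym (HasRuns-sum h) (≤-trans weight≤ weight₀≤))
    where
    size≡ = trans size≡n (sym size₀)
    weight≤ : weight bs ≤ weight bs₀
    weight≤ = weight-maximal {bs} {bs₀} size≡ defect₀
    weight₀≤ : weight bs₀ ≤ sum (lehmer π)
    weight₀≤ = subst₂ _≤_ invτ (inv≡sum-lehmer π) (max τ avτ)

-- Closed form of the maximal weight

2*[n+1]C2 : ∀ n → 2 * (suc n C 2) ≡ n * suc n
2*[n+1]C2 zero    = refl
2*[n+1]C2 (suc n) = begin
  2 * (suc (suc n) C 2)             ≡⟨ cong (2 *_) (nCk+nC[k+1]≡[n+1]C[k+1] (suc n) 1) ⟨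
  2 * (suc n C 1 + suc n C 2)       ≡⟨ *-distribˡ-+ 2 (suc n C 1) (suc n C 2) ⟩
  2 * (suc n C 1) + 2 * (suc n C 2) ≡⟨ cong₂ (λ x y → 2 * x + y) (nC1≡n (suc n)) (2*[n+1]C2 n) ⟩
  2 * suc n + n * suc n             ≡⟨ eq n ⟩
  suc n * suc (suc n)               ∎
  where
  open ≡-Reasoning
  eq : ∀ n → 2 * suc n + n * suc n ≡ suc n * suc (suc n)
  eq = solve-∀

2*[r+2]C3 : ∀ r → 2 * (suc (suc r) C 3) ≡ tet r
2*[r+2]C3 zero    = refl
2*[r+2]C3 (suc r) = begin
  2 * (suc (suc (suc r)) C 3)                   ≡⟨ cong (2 *_) (nCk+nC[k+1]≡[n+1]C[k+1] (suc (suc r)) 2) ⟨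
  2 * (suc (suc r) C 2 + suc (suc r) C 3)       ≡⟨ *-distribˡ-+ 2 (suc (suc r) C 2) _ ⟩
  2 * (suc (suc r) C 2) + 2 * (suc (suc r) C 3) ≡⟨ cong₂ _+_ (2*[n+1]C2 (suc r)) (2*[r+2]C3 r) ⟩
  suc r * suc (suc r) + tet r                   ∎
  where open ≡-Reasoning

-- With `suc y` in place of N - r, the term C(N - r, 2) of the bound needs no subtraction.
maximum-weight : ∀ {bs r} y → size bs ≡ suc (y + r) → defect bs r ≡ 0 →
  weight bs ≡ suc y C 2 + suc (suc r) C 3
maximum-weight {bs} {r} y size≡ defect≡0 = *-cancelˡ-≡ _ _ 2
  (trans (+-cancelʳ-≡ (2 * (s * r) + s) _ _ (begin
    2 * weight bs + (2 * (s * r) + s)                   ≡⟨ +-identityʳ _ ⟨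
    2 * weight bs + (2 * (s * r) + s) + 0               ≡⟨ cong (λ d → 2 * weight bs + (2 * (s * r) + s) + d) defect≡0 ⟨
    2 * weight bs + (2 * (s * r) + s) + defect bs r     ≡⟨ weight-identity bs r ⟩
    s * s + (r * r + r) + tet r                         ≡⟨ cong (λ s → s * s + (r * r + r) + tet r) size≡ ⟩
    suc (y + r) * suc (y + r) + (r * r + r) + tet r     ≡⟨ eq y r (tet r) ⟩
    y * suc y + tet r + (2 * (suc (y + r) * r) + suc (y + r))
      ≡⟨ cong (λ s → y * suc y + tet r + (2 * (s * r) + s)) size≡ ⟨
    y * suc y + tet r + (2 * (s * r) + s)               ∎))
  (sym (trans (*-distribˡ-+ 2 (suc y C 2) _) (cong₂ _+_ (2*[n+1]C2 y) (2*[r+2]C3 r)))))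
  where
  open ≡-Reasoning
  s = size bs
  eq : ∀ y r t → suc (y + r) * suc (y + r) + (r * r + r) + t
               ≡ y * suc y + t + (2 * (suc (y + r) * r) + suc (y + r))
  eq = solve-∀

T-suc : ∀ r → T (suc r) ≡ suc r + T r
T-suc r = trans (sym (nCk+nC[k+1]≡[n+1]C[k+1] (suc r) 1)) (cong (_+ T r) (nC1≡n (suc r)))

base-0 : ∀ r → base 0 r ≡ T r
base-0 zero    = refl
base-0 (suc r) = trans (cong (λ x → suc r + x) (base-0 r)) (sym (T-suc r))

-- The summands of `base 1 r` are 2, ..., r + 1; the `suc` supplies the missing 1.
base-1 : ∀ r → suc (base 1 r) ≡ T (suc r)
base-1 zero    = refl
base-1 (suc r) = trans (sym (+-suc (suc (suc r)) (base 1 r)))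
  (trans (cong (λ x → suc (suc r) + x) (base-1 r)) (sym (T-suc (suc r))))

-- The triangular numbers around n + 2

8*T : ∀ r → 8 * T r ≡ 4 * (r * suc r)
8*T r = trans (*-assoc 4 2 (T r)) (cong (4 *_) (2*[n+1]C2 r))

-- Since 8 T(i) + 1 = (2i + 1)², comparing triangular numbers with n + 2 amounts to the squared
-- inequalities of `ρ-floor`.
T[ρ+1]≤n+2 : ∀ n → T (suc (ρ n)) ≤ n + 2
T[ρ+1]≤n+2 n = *-cancelˡ-≤ 8 (+-cancelʳ-≤ 1 _ _ (begin
  8 * T (suc r) + 1               ≡⟨ cong (_+ 1) (8*T (suc r)) ⟩
  4 * (suc r * suc (suc r)) + 1   ≡⟨ eq r ⟩
  (2 * r + 3) * (2 * r + 3)       ≤⟨ proj₁ (ρ-floor n) ⟩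
  8 * n + 17                      ≡⟨ eq′ n ⟩
  8 * (n + 2) + 1                 ∎))
  where
  open ≤-Reasoning
  r = ρ n
  eq : ∀ r → 4 * (suc r * suc (suc r)) + 1 ≡ (2 * r + 3) * (2 * r + 3)
  eq = solve-∀
  eq′ : ∀ n → 8 * n + 17 ≡ 8 * (n + 2) + 1
  eq′ = solve-∀

n+2<T[ρ+2] : ∀ n → n + 2 < T (suc (suc (ρ n)))
n+2<T[ρ+2] n = *-cancelˡ-< 8 _ _ (+-cancelʳ-< 1 _ _ (begin-strict
  8 * (n + 2) + 1                           ≡⟨ eq′ n ⟩
  8 * n + 17                                <⟨ proj₂ (ρ-floor n) ⟩
  (2 * r + 5) * (2 * r + 5)                 ≡⟨ eq r ⟩
  4 * (suc (suc r) * suc (suc (suc r))) + 1 ≡⟨ cong (_+ 1) (8*T (suc (suc r))) ⟨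
  8 * T (suc (suc r)) + 1                   ∎))
  where
  open ≤-Reasoning
  r = ρ n
  eq : ∀ r → (2 * r + 5) * (2 * r + 5) ≡ 4 * (suc (suc r) * suc (suc (suc r))) + 1
  eq = solve-∀
  eq′ : ∀ n → 8 * (n + 2) + 1 ≡ 8 * n + 17
  eq′ = solve-∀

λℕ : ℕ → ℕ
λℕ n = n + 2 ∸ T (suc (ρ n))

λℕ-+ : ∀ n → T (suc (ρ n)) + λℕ n ≡ n + 2
λℕ-+ n = m+[n∸m]≡n (T[ρ+1]≤n+2 n)

-- The triangular numbers of index ρ + 1 and ρ + 2 differ by ρ + 2, and n + 2 lies strictly below
-- the second. This bound guarantees that an optimal run sequence exists.
λℕ≤1+ρ : ∀ n → λℕ n ≤ suc (ρ n)
λℕ≤1+ρ n = s≤s⁻¹ (+-cancelˡ-< (T (suc (ρ n))) _ _ (begin-strict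
  T (suc (ρ n)) + λℕ n            ≡⟨ λℕ-+ n ⟩
  n + 2                           <⟨ n+2<T[ρ+2] n ⟩
  T (suc (suc (ρ n)))             ≡⟨ T-suc (suc (ρ n)) ⟩
  suc (suc (ρ n)) + T (suc (ρ n)) ≡⟨ +-comm (suc (suc (ρ n))) _ ⟩
  T (suc (ρ n)) + suc (suc (ρ n)) ∎))
  where open ≤-Reasoning

lam≡+λℕ : ∀ n → lam n ≡ + λℕ n
lam≡+λℕ n = begin
  + (n + 2) ℤ.- + T (ρ n + 1)     ≡⟨ cong (λ x → + (n + 2) ℤ.- + T x) (+-comm (ρ n) 1) ⟩
  + (n + 2) ℤ.- + T (suc (ρ n))   ≡⟨ ℤ.[+m]-[+n]≡m⊖n (n + 2) (T (suc (ρ n))) ⟩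
  (n + 2) ℤ.⊖ T (suc (ρ n))       ≡⟨ ℤ.⊖-≥ (T[ρ+1]≤n+2 n) ⟩
  + λℕ n                          ∎
  where open ≡-Reasoning

-- Enumeration of the optimal run sequences

longer-layouts : ℕ → ℕ → List (List ℕ)
longer-layouts r zero    = []
longer-layouts r (suc l) = layouts 0 (suc r) l

-- The least size of r + 1 runs with offset 0 exceeds that of r runs with offset 1 by one. For equal
-- total size the second family therefore has one long run fewer, and it is empty for l = 0.
optimal-runs : ℕ → ℕ → List (List ℕ)
optimal-runs r l = layouts 1 r l ++ longer-layouts r l

Layout-length : ∀ {o k l bs} → Layout o k l bs → length bs ≡ k
Layout-length []        = refl
Layout-length (short h) = cong suc (Layout-length h)
Layout-length (long h)  = cong suc (Layout-length h)

∈-longer⁻ : ∀ r l {bs} → bs ∈ longer-layouts r l → ∃[ l′ ] Layout 0 (suc r) l′ bs × l ≡ suc l′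
∈-longer⁻ r (suc l) bs∈ = l , ∈-layouts⁻ 0 (suc r) l bs∈ , refl

∈-optimal-runs⁻ : ∀ r l {bs} → bs ∈ optimal-runs r l →
  Layout 1 r l bs ⊎ ∃[ l′ ] Layout 0 (suc r) l′ bs × l ≡ suc l′
∈-optimal-runs⁻ r l bs∈ with ∈-++⁻ (layouts 1 r l) bs∈
... | inj₁ p = inj₁ (∈-layouts⁻ 1 r l p)
... | inj₂ p = inj₂ (∈-longer⁻ r l p)

optimal-runs-unique : ∀ r l → Unique (optimal-runs r l)
optimal-runs-unique r l = Unique.++⁺ (layouts-unique 1 r l) (longer-unique l)
  -- The families are disjoint because their members have r and r + 1 runs.
  λ (p , q) → 1+n≢n (trans (sym (Layout-length (proj₁ (proj₂ (∈-longer⁻ r l q)))))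
                           (Layout-length (∈-layouts⁻ 1 r l p)))
  where
  longer-unique : ∀ l → Unique (longer-layouts r l)
  longer-unique zero    = []
  longer-unique (suc l) = layouts-unique 0 (suc r) l

length-optimal-runs : ∀ r l → length (optimal-runs r l) ≡ binom r (+ l) + binom (r + 1) (+ l ℤ.- + 1)
length-optimal-runs r l = trans (length-++ (layouts 1 r l)) (cong₂ _+_ (length-layouts 1 r l) (longer l))
  where
  longer : ∀ l → length (longer-layouts r l) ≡ binom (r + 1) (+ l ℤ.- + 1)
  longer zero    = refl
  longer (suc l) = trans (length-layouts 0 (suc r) l) (cong (_C l) (+-comm 1 r))

-- For N = n + 1 and r = ρ the hypothesis is the equation T(ρ + 1) + λ = n + 2 that defines λ.
module _ {N r l} (T+l : T (suc r) + l ≡ suc N) where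

  base-1-+ : base 1 r + l ≡ N
  base-1-+ = suc-injective (trans (cong (_+ l) (base-1 r)) T+l)

  base-0-+ : ∀ {l′} → l ≡ suc l′ → base 0 (suc r) + l′ ≡ N
  base-0-+ {l′} refl = suc-injective
    (trans (sym (+-suc (base 0 (suc r)) l′)) (trans (cong (_+ suc l′) (base-0 (suc r))) T+l))

  optimal-runs-sound : ∀ {bs} → bs ∈ optimal-runs r l → size bs ≡ N × defect bs r ≡ 0
  optimal-runs-sound bs∈ with ∈-optimal-runs⁻ r l bs∈
  ... | inj₁ h             = trans (Layout-size h) base-1-+ , defect≡0⁺ (inj₁ (l , h))
  ... | inj₂ (l′ , h , l≡) = trans (Layout-size h) (base-0-+ l≡) , defect≡0⁺ (inj₂ (l′ , h))

  -- Defect 0 gives a layout with some number of long runs, and the size determines that number.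
  optimal-runs-complete : ∀ {bs} → size bs ≡ N → defect bs r ≡ 0 → bs ∈ optimal-runs r l
  optimal-runs-complete {bs} size≡ defect≡0 with defect≡0⁻ bs r defect≡0
  ... | inj₁ (l′ , h)
    with refl ← +-cancelˡ-≡ (base 1 r) l′ l (trans (sym (Layout-size h)) (trans size≡ (sym base-1-+)))
    = ∈-++⁺ˡ (∈-layouts⁺ h)
  ... | inj₂ (l′ , h) = subst (λ l → bs ∈ optimal-runs r l) l≡
                              (∈-++⁺ʳ (layouts 1 r (suc l′)) (∈-layouts⁺ h))
    where
    open ≡-Reasoning
    l≡ : suc l′ ≡ l
    l≡ = +-cancelˡ-≡ (T (suc r)) _ _ (begin
      T (suc r) + suc l′        ≡⟨ +-suc (T (suc r)) l′ ⟩
      suc (T (suc r) + l′)      ≡⟨ cong (λ x → suc (x + l′)) (base-0 (suc r)) ⟨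
      suc (base 0 (suc r) + l′) ≡⟨ cong suc (trans (sym (Layout-size h)) size≡) ⟩
      suc N                     ≡⟨ T+l ⟨
      T (suc r) + l             ∎)

-- The second family is empty for l = 0 and the first for l = r + 1, so the witness comes from the
-- first only when l = 0.
optimal-runs-nonempty : ∀ {r l} → l ≤ suc r → ∃[ bs ] bs ∈ optimal-runs r l
optimal-runs-nonempty {r} {zero}  _         =
  let (bs , h) = Layout-exists 1 {r} z≤n in bs , ∈-++⁺ˡ (∈-layouts⁺ h)
optimal-runs-nonempty {r} {suc l} (s≤s l≤r) =
  let (bs , h) = Layout-exists 0 {suc r} (m≤n⇒m≤1+n l≤r) in bs , ∈-++⁺ʳ (layouts 1 r (suc l)) (∈-layouts⁺ h)

module Optimum {n r l} (r≤n : r ≤ n) (T+l : T (suc r) + l ≡ suc (suc n)) (l≤1+r : l ≤ suc r) where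

  private
    bs₀ = proj₁ (optimal-runs-nonempty l≤1+r)

    sound : ∀ {bs} → bs ∈ optimal-runs r l → size bs ≡ suc n × defect bs r ≡ 0
    sound = optimal-runs-sound T+l

    bs₀-sound : size bs₀ ≡ suc n × defect bs₀ r ≡ 0
    bs₀-sound = sound (proj₂ (optimal-runs-nonempty l≤1+r))

    open Maximum {suc n} {r} {bs₀} (proj₁ bs₀-sound) (proj₂ bs₀-sound)

    codes = map fill (optimal-runs r l)

    𝒵⇔ : ∀ π → 𝒵 {suc n} Avoids32-1 π ⇔ lehmer π ∈ codes
    𝒵⇔ π = mk⇔
      (λ z → let (bs , size≡ , defect≡0 , eq) = 𝒵⁻ {π} z in
        subst (_∈ codes) (sym eq) (∈-map⁺ fill (optimal-runs-complete T+l size≡ defect≡0)))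
      (λ c∈ → let (bs , bs∈ , eq) = ∈-map⁻ fill c∈ in
        𝒵⁺ {bs} {π} (proj₁ (sound bs∈)) (proj₂ (sound bs∈)) eq)

    realise : ∀ {c} → c ∈ codes → ∃[ π ] lehmer {suc n} π ≡ c
    realise c∈ with ∈-map⁻ fill c∈
    ... | bs , bs∈ , refl = fill-perm bs (proj₁ (sound bs∈))

  card-𝒵 : Card (𝒵 {suc n} Avoids32-1) (binom r (+ l) + binom (r + 1) (+ l ℤ.- + 1))
  card-𝒵 = subst (Card (𝒵 Avoids32-1))
    (trans (length-map fill (optimal-runs r l)) (length-optimal-runs r l))
    (card-by-lehmer (Unique.map⁺ fill-injective (optimal-runs-unique r l)) 𝒵⇔ realise)

  maximum : ∃[ π ] 𝒵 {suc n} Avoids32-1 π × inv π ≡ (n ∸ r + 1) C 2 + (r + 2) C 3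
  maximum = let (π , z , eq) = witness in π , z , trans eq weight≡
    where
    open ≡-Reasoning
    weight≡ : weight bs₀ ≡ (n ∸ r + 1) C 2 + (r + 2) C 3
    weight≡ = begin
      weight bs₀                          ≡⟨ maximum-weight {bs₀} (n ∸ r) size≡ (proj₂ bs₀-sound) ⟩
      suc (n ∸ r) C 2 + suc (suc r) C 3   ≡⟨ cong (λ x → x C 2 + suc (suc r) C 3) (+-comm 1 (n ∸ r)) ⟩
      (n ∸ r + 1) C 2 + suc (suc r) C 3   ≡⟨ cong (λ x → (n ∸ r + 1) C 2 + x C 3) (+-comm 2 r) ⟩
      (n ∸ r + 1) C 2 + (r + 2) C 3       ∎
      where
      size≡ : size bs₀ ≡ suc (n ∸ r + r)
      size≡ = trans (proj₁ bs₀-sound) (cong suc (sym (m∸n+n≡m r≤n)))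

-- Return to the three given patterns

difference : ∀ {a b c d} → a + (c + b) ≡ d → + a ≡ + d ℤ.- + b ℤ.- + c
difference {a} {b} {c} refl = sym (begin
  + (a + (c + b)) ℤ.- + b ℤ.- + c   ≡⟨ cong (λ x → + x ℤ.- + b ℤ.- + c) (sym (+-assoc a c b)) ⟩
  + (a + c) ℤ.+ + b ℤ.- + b ℤ.- + c ≡⟨ cong (ℤ._- + c) (cancel (+ (a + c)) (+ b)) ⟩
  + (a + c) ℤ.- + c                 ≡⟨ cancel (+ a) (+ c) ⟩
  + a                               ∎)
  where
  open ≡-Reasoning
  cancel : ∀ i j → i ℤ.+ j ℤ.- j ≡ i
  cancel i j = trans (ℤ.+-assoc i j (ℤ.- j)) (trans (cong (λ x → i ℤ.+ x) (ℤ.+-inverseʳ j)) (ℤ.+-identityʳ i))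

corollary1p4 : ∀ (n : ℕ) → n ≥ 1 →
    let N = suc n
        size = binom (ρ n) (lam n) + binom (ρ n + 1) (lam n ℤ.- + 1)
        minimum = + ((n + 1) C 2) ℤ.- + ((ρ n + 2) C 3) ℤ.- + ((n ∸ ρ n + 1) C 2)
    in  Card {N} (𝒵 Avoids3-21) size
      × Card {N} (𝒴 Avoids1-23) size
      × Card {N} (𝒴 Avoids12-3) size
      × MaxInv {N} Avoids3-21 (+ ((n ∸ ρ n + 1) C 2 + (ρ n + 2) C 3))
      × MinInv {N} Avoids1-23 minimum
      × MinInv {N} Avoids12-3 minimum
corollary1p4 n _ =
    X3-21.card Z3-21.𝒵⇔ card-𝒵′
  , X1-23.card Y1-23.𝒴⇔ card-𝒵′
  , X12-3.card Y12-3.𝒴⇔ card-𝒵′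
  , (half-turn π , Equivalence.from (Z3-21.𝒵⇔ (half-turn π))
      (𝒵-resp-≈ {π = π} {half-turn (half-turn π)} (λ i → sym (half-turn-involutive π i)) π∈𝒵)
    , cong +_ (trans (inv-half-turn π) inv-π))
  , (reversal π , Equivalence.from (Y1-23.𝒴⇔ (reversal π))
      (𝒵-resp-≈ {π = π} {reversal (reversal π)} (λ i → sym (reversal-involutive π i)) π∈𝒵)
    , minimal (inv-reversal π))
  , (complement π , Equivalence.from (Y12-3.𝒴⇔ (complement π))
      (𝒵-resp-≈ {π = π} {complement (complement π)} (λ i → sym (complement-involutive π i)) π∈𝒵)
    , minimal (inv-complement π))
  where
  open Optimum (ρ≤n n) (trans (λℕ-+ n) (+-comm n 2)) (λℕ≤1+ρ n)

  -- The half-turn keeps `inv`, so maximisers stay maximisers; reversal and complement reflect it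
  -- about C(n + 1, 2), so the minimisers for 1-23 and 12-3 become maximisers for 32-1.
  module X3-21 = Transfer half-turn
    (λ π≈τ i → cong opposite (π≈τ (opposite i))) half-turn-involutive 3-21⇔32-1
  module X1-23 = Transfer reversal (λ π≈τ i → π≈τ (opposite i)) reversal-involutive 1-23⇔32-1
  module X12-3 = Transfer complement
    (λ π≈τ i → cong opposite (π≈τ i)) complement-involutive 12-3⇔32-1
  module Z3-21 = X3-21.Preserving inv-half-turn
  module Y1-23 = X1-23.Reversing inv-reversal
  module Y12-3 = X12-3.Reversing inv-complement

  card-𝒵′ : Card (𝒵 {suc n} Avoids32-1) (binom (ρ n) (lam n) + binom (ρ n + 1) (lam n ℤ.- + 1))
  card-𝒵′ = subst (λ z → Card (𝒵 {suc n} Avoids32-1) (binom (ρ n) z + binom (ρ n + 1) (z ℤ.- + 1)))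
    (sym (lam≡+λℕ n)) card-𝒵

  π : Permutation′ (suc n)
  π = proj₁ maximum
  π∈𝒵 : 𝒵 Avoids32-1 π
  π∈𝒵 = proj₁ (proj₂ maximum)
  inv-π : inv π ≡ (n ∸ ρ n + 1) C 2 + (ρ n + 2) C 3
  inv-π = proj₂ (proj₂ maximum)

  minimal : ∀ {v} → inv π + v ≡ suc n C 2 →
            + v ≡ + ((n + 1) C 2) ℤ.- + ((ρ n + 2) C 3) ℤ.- + ((n ∸ ρ n + 1) C 2)
  minimal {v} eq = difference {b = (ρ n + 2) C 3} {c = (n ∸ ρ n + 1) C 2} (begin
    v + ((n ∸ ρ n + 1) C 2 + (ρ n + 2) C 3) ≡⟨ cong (λ x → v + x) inv-π ⟨
    v + inv π                               ≡⟨ +-comm v (inv π) ⟩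
    inv π + v                               ≡⟨ eq ⟩
    suc n C 2                               ≡⟨ cong (_C 2) (+-comm 1 n) ⟩
    (n + 1) C 2                             ∎)
    where open ≡-Reasoning
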